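{- If a rule set $\mathcal{R}$ is deterministic restricted prefix-cyclic (DRPC), it never-terminates.
   Context: Setting (restricted disjunctive chase). Rules $\rho$: $\forall \vec w,\vec x.[\beta\to \bigvee_{i=1}^n \exists \vec y_i.\eta_i]$ with frontier $\vec x$, $\mathrm{branching}(\rho)=n$; $\rho$ is deterministic if $n=1$, datalog if deterministic without existential variables; skolemization $\mathrm{sk}(\rho)$ replaces $y\in\vec y_i$ by $f^\rho_{i,y}(\vec x)$. Trigger $\lambda=(\rho,\sigma)$ (deterministic if $\rho$ is): loaded for $F$ if $\mathrm{body}(\rho)\sigma\subseteq F$; obsolete for $F$ if some extension $\sigma'$ of $\sigma$ gives $\mathrm{head}_i(\rho)\sigma'\subseteq F$; $\mathrm{out}_i(\lambda)=\mathrm{head}_i(\mathrm{sk}(\rho))\sigma$; $\mathcal{R}$-triggers use rules of $\mathcal{R}$ and substitutions into terms over $\mathrm{sk}(\mathcal{R})$. Chase trees of $(\mathcal{R},D)$ are rooted at $D$, apply loaded non-obsolete $\mathcal{R}$-triggers (datalog first) with one child per disjunct, leaves satisfy all rules, fairness holds; $\mathcal{R}$ never-terminates if some KB with $\mathcal{R}$ has no finite chase tree. Birth facts: $\mathrm{birth}(c)=\emptyset$; $\mathrm{birth}(f^\psi_{i,v}(\vec s))=\mathrm{out}_i((\psi,\tau))\cup\bigcup_s\mathrm{birth}(s)$ with $\tau$ mapping $\mathrm{frontier}(\psi)$ to $\vec s$; $\mathrm{birth}((\psi,\tau))=\bigcup_{x\in\mathrm{frontier}(\psi)}\mathrm{birth}(\tau(x))$;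 $\mathrm{skel}(\lambda)$ = terms of $\mathrm{birth}(\lambda)$ plus constants assigned to frontier variables. $h^\star_\lambda$ maps terms of $\mathrm{skel}(\lambda)$ to themselves and all others to a special constant $\star$. $\mathcal{O}(\mathcal{R},\lambda,h)$ is the minimal fact set containing all facts over predicates of $\mathcal{R}$ and constants in $\mathrm{skel}(\lambda)\cup\{\star\}$, including $\mathrm{birth}(\lambda)$, and including $h(\bigcup_i\mathrm{out}_i(\lambda'))$ for every $\mathcal{R}$-trigger $\lambda'=(\psi,\tau)$ loaded for it such that if $\psi=\rho$ then $\mathrm{out}_i(\lambda')\neq\mathrm{out}_i(\lambda)$ for some $i$. $\lambda$ is $\star$-unblockable for $\mathcal{R}$ if its rule is datalog or it is not obsolete for $\mathcal{O}(\mathcal{R},\lambda,h^\star_\lambda)$. $D_\rho=\mathrm{body}(\rho)\sigma_{uc}$ with $\sigma_{uc}$ mapping each variable $x$ to a fresh constant $c_x$. A term is cyclic if it has a subterm $f(\vec s)$ with $f$ occurring in $\vec s$; $\rho$-cyclic if it is $f(\vec s)$ with $f$ from $\mathrm{sk}(\rho)$ occurring in $\vec s$. For a deterministic $\rho\in\mathcal{R}$, $\mathrm{DRPC}(\mathcal{R},\rho)$ is the (least) fact set including $D_\rho$, $\mathrm{out}_1((\rho,\sigma_{uc}))$, and $\mathrm{out}_1(\lambda)$ for every deterministic $\mathcal{R}$-trigger $\lambda=(\psi,\tau)$ with no cyclic term in the range of $\tau$, loaded for $\mathrm{DRPC}(\mathcal{R},\rho)$, $\star$-unblockable for $\mathcal{R}$,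 and with $\tau$ injective if $\psi=\rho$. $\mathcal{R}$ is DRPC if there is a deterministic (generating) $\rho\in\mathcal{R}$ and a $\rho$-cyclic term occurring in $\mathrm{DRPC}(\mathcal{R},\rho)$. -}

module Defs where

open import Data.Nat using (ℕ; zero; suc; _<_; _≟_)
open import Data.Fin using (Fin; toℕ)
open import Data.List using (List; []; _∷_; _++_; map; concatMap; concat; filter; length; deduplicate)
import Data.List.NonEmpty as L⁺
open import Data.List.Membership.Propositional using (_∈_; _∉_)
open import Data.List.Membership.DecPropositional _≟_ using (_∈?_)
open import Data.List.Relation.Unary.All using (All)
open import Data.List.Relation.Unary.Any using (Any)
open import Data.Vec using (Vec; toList)
import Data.Vec as Vec
import Data.Vec.Relation.Unary.All as VAll
open import Data.Vec.Relation.Binary.Pointwise.Inductive using (Pointwise)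
open import Data.Product using (Σ; ∃; ∃-syntax; _×_; _,_)
open import Data.Sum using (_⊎_)
open import Relation.Nullary using (¬_; yes; no)
open import Relation.Binary.PropositionalEquality using (_≡_)

Var : Set
Var = ℕ

record Pred : Set where
  constructor mkPred
  field
    name  : ℕ
    arity : ℕ

record Atom (A : Set) : Set where
  constructor _⟨_⟩
  field
    pred : Pred
    args : Vec A (Pred.arity pred)
open Atom public

mapAtom : {A B : Set} → (A → B) → Atom A → Atom B
mapAtom f (p ⟨ ts ⟩) = p ⟨ Vec.map f ts ⟩

-- A (disjunctive, existential) rule  ∀ w x. β → ⋁_{i} ∃ y_i. η_i .
-- Rules are constant-free; universally quantified variables are the
-- variables of the body, existential variables of disjunct i are the
-- variables of head i not occurring in the body.  There is at least one
-- disjunct (n ≥ 1).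
record Rule : Set where
  constructor mkRule
  field
    body  : List (Atom Var)
    heads : L⁺.List⁺ (List (Atom Var))
open Rule public

atomsVars : List (Atom Var) → List Var
atomsVars = concatMap (λ a → toList (args a))

headList : Rule → List (List (Atom Var))
headList ρ = L⁺.toList (heads ρ)

branching : Rule → ℕ
branching ρ = length (headList ρ)

nth : List (List (Atom Var)) → ℕ → List (Atom Var)
nth []       _       = []
nth (h ∷ hs) zero    = h
nth (h ∷ hs) (suc i) = nth hs i

headN : Rule → ℕ → List (Atom Var)
headN ρ i = nth (headList ρ) i

bodyVars : Rule → List Var
bodyVars ρ = atomsVars (body ρ)

allHeadVars : Rule → List Var
allHeadVars ρ = atomsVars (concat (headList ρ))

frontier : Rule → List Var
frontier ρ = filter (_∈? allHeadVars ρ) (deduplicate _≟_ (bodyVars ρ))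

Deterministic : Rule → Set
Deterministic ρ = branching ρ ≡ 1

Datalog : Rule → Set
Datalog ρ = Deterministic ρ × (∀ v → v ∈ allHeadVars ρ → v ∈ bodyVars ρ)

Generating : Rule → Set
Generating ρ = ¬ Datalog ρ

predsOf : Rule → List Pred
predsOf ρ = map pred (body ρ ++ concat (headList ρ))

PredOf : List Rule → Pred → Set
PredOf R p = Any (λ ρ → p ∈ predsOf ρ) R

data Const : Set where
  nat : ℕ → Const
  ⋆   : Const

-- Skolem function symbol f^ρ_{i,y} (i is the 0-based disjunct index).
FunSym : Set
FunSym = Rule × ℕ × Var

data Term : Set where
  const : Const → Term
  fn    : FunSym → List Term → Term

Fact : Set
Fact = Atom Term

FactSet : Set₁
FactSet = Fact → Set

Subst : Set
Subst = Var → Term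

data _⊑_ : Term → Term → Set where
  ⊑-refl : ∀ {t} → t ⊑ t
  ⊑-arg  : ∀ {t s f ss} → s ∈ ss → t ⊑ s → t ⊑ fn f ss

OccursFun : FunSym → Term → Set
OccursFun f t = ∃[ ss ] (fn f ss ⊑ t)

Cyclic : Term → Set
Cyclic t = ∃[ f ] ∃[ ss ] (fn f ss ⊑ t × Any (OccursFun f) ss)

RhoCyclic : Rule → Term → Set
RhoCyclic ρ t = ∃[ i ] ∃[ v ] ∃[ ss ]
  (t ≡ fn (ρ , i , v) ss × Any (OccursFun (ρ , i , v)) ss)

data OverSk (R : List Rule) : Term → Set where
  ov-const : ∀ c → OverSk R (const c)
  ov-fn    : ∀ {ψ i v ss} → ψ ∈ R → i < branching ψ →
             v ∈ atomsVars (headN ψ i) → v ∉ bodyVars ψ →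
             length ss ≡ length (frontier ψ) → All (OverSk R) ss →
             OverSk R (fn (ψ , i , v) ss)

record Trigger : Set where
  constructor trig
  field
    rule  : Rule
    subst : Subst
open Trigger public

skSubst : Rule → Subst → ℕ → Subst
skSubst ρ σ i v with v ∈? bodyVars ρ
... | yes _ = σ v
... | no  _ = fn (ρ , i , v) (map σ (frontier ρ))

outN : Rule → Subst → ℕ → List Fact
outN ρ σ i = map (mapAtom (skSubst ρ σ i)) (headN ρ i)

out : Trigger → ℕ → List Fact
out (trig ρ σ) i = outN ρ σ i

Loaded : FactSet → Trigger → Set
Loaded F (trig ρ σ) = All (λ a → F (mapAtom σ a)) (body ρ)

Obsolete : FactSet → Trigger → Set
Obsolete F (trig ρ σ) = ∃[ i ] (i < branching ρ × ∃[ σ' ]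
  ((∀ x → x ∈ bodyVars ρ → σ' x ≡ σ x) ×
   All (λ a → F (mapAtom σ' a)) (headN ρ i)))

RTrigger : List Rule → Trigger → Set
RTrigger R (trig ρ σ) = ρ ∈ R × (∀ x → x ∈ bodyVars ρ → OverSk R (σ x))

DeterministicT : Trigger → Set
DeterministicT λ′ = Deterministic (rule λ′)

DatalogT : Trigger → Set
DatalogT λ′ = Datalog (rule λ′)

_∈F_ : Fact → List Fact → Set
a ∈F F = a ∈ F

SameSet : List Fact → List Fact → Set
SameSet L M = (∀ a → a ∈ L → a ∈ M) × (∀ a → a ∈ M → a ∈ L)

-- A finite chase tree of (R, F) rooted at F.  A node applies a loaded,
-- non-obsolete R-trigger, which may be non-datalog only if no loaded
-- non-obsolete datalog R-trigger exists; it has one child per disjunct.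
-- Leaves satisfy all rules.  (Fairness is automatic for finite trees.)
data FinChaseTree (R : List Rule) : List Fact → Set where
  leaf : ∀ {F} →
         (∀ λ′ → rule λ′ ∈ R → Loaded (_∈F F) λ′ → Obsolete (_∈F F) λ′) →
         FinChaseTree R F
  node : ∀ {F} (λ′ : Trigger) → RTrigger R λ′ →
         Loaded (_∈F F) λ′ → ¬ Obsolete (_∈F F) λ′ →
         (¬ DatalogT λ′ → ∀ μ → RTrigger R μ → DatalogT μ →
            Loaded (_∈F F) μ → Obsolete (_∈F F) μ) →
         ((i : Fin (branching (rule λ′))) →
            FinChaseTree R (F ++ out λ′ (toℕ i))) →
         FinChaseTree R F

Database : Set
Database = List (Atom Const)

dbFacts : Database → List Fact
dbFacts = map (mapAtom const)

NeverTerminates : List Rule → Set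
NeverTerminates R = ∃[ D ] ¬ FinChaseTree R (dbFacts D)

τFrom : List Var → List Term → Subst
τFrom []       _        x = const ⋆
τFrom (y ∷ ys) []       x = const ⋆
τFrom (y ∷ ys) (s ∷ ss) x with x ≟ y
... | yes _ = s
... | no  _ = τFrom ys ss x

mutual
  birth : Term → List Fact
  birth (const c)            = []
  birth (fn (ψ , i , v) ss)  = outN ψ (τFrom (frontier ψ) ss) i ++ births ss

  births : List Term → List Fact
  births []       = []
  births (s ∷ ss) = birth s ++ births ss

birthT : Trigger → List Fact
birthT (trig ψ τ) = concatMap (λ x → birth (τ x)) (frontier ψ)

InSkel : Trigger → Term → Set
InSkel λ′ t =
  Any (λ a → t ∈ toList (args a)) (birthT λ′) ⊎
  (∃[ c ] (t ≡ const c) × ∃[ x ] (x ∈ frontier (rule λ′) × subst λ′ x ≡ t))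

ConstSkelStar : Trigger → Term → Set
ConstSkelStar λ′ t = t ≡ const ⋆ ⊎ (∃[ c ] (t ≡ const c) × InSkel λ′ t)

HStar : Trigger → Term → Term → Set
HStar λ′ t t' = (InSkel λ′ t × t' ≡ t) ⊎ (¬ InSkel λ′ t × t' ≡ const ⋆)

data O (R : List Rule) (λ′ : Trigger) : Fact → Set where
  o-base  : ∀ {p ts} → PredOf R p → VAll.All (ConstSkelStar λ′) ts →
            O R λ′ (p ⟨ ts ⟩)
  o-birth : ∀ {a} → a ∈ birthT λ′ → O R λ′ a
  o-out   : ∀ (μ : Trigger) → RTrigger R μ → Loaded (O R λ′) μ →
            (rule μ ≡ rule λ′ →
               ∃[ i ] (i < branching (rule λ′) × ¬ SameSet (out μ i) (out λ′ i))) →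
            ∀ i {p ts ts'} → (p ⟨ ts ⟩) ∈ out μ i →
            Pointwise (HStar λ′) ts ts' → O R λ′ (p ⟨ ts' ⟩)

StarUnblockable : List Rule → Trigger → Set
StarUnblockable R λ′ = DatalogT λ′ ⊎ ¬ Obsolete (O R λ′) λ′

σuc : Subst
σuc x = const (nat x)

Dρ : Rule → List Fact
Dρ ρ = map (mapAtom σuc) (body ρ)

InjectiveOn : List Var → Subst → Set
InjectiveOn xs τ = ∀ x y → x ∈ xs → y ∈ xs → τ x ≡ τ y → x ≡ y

data DRPCSet (R : List Rule) (ρ : Rule) : Fact → Set where
  d-db   : ∀ {a} → a ∈ Dρ ρ → DRPCSet R ρ a
  d-rho  : ∀ {a} → a ∈ outN ρ σuc 0 → DRPCSet R ρ a
  d-trig : ∀ (μ : Trigger) {a} → DeterministicT μ → RTrigger R μ →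
           (∀ x → x ∈ bodyVars (rule μ) → ¬ Cyclic (subst μ x)) →
           Loaded (DRPCSet R ρ) μ → StarUnblockable R μ →
           (rule μ ≡ ρ → InjectiveOn (bodyVars ρ) (subst μ)) →
           a ∈ out μ 0 → DRPCSet R ρ a

DRPC : List Rule → Set
DRPC R = ∃[ ρ ] (ρ ∈ R × Deterministic ρ × Generating ρ ×
           ∃[ a ] (DRPCSet R ρ a × Any (RhoCyclic ρ) (toList (args a))))

{-# OPTIONS --safe #-}
module Submission where

-- Let ρ witness DRPC.  Every trigger whose frontier consists of constants is obsolete for the
-- ⋆-overapproximation, so apart from the initial trigger (ρ , σuc) each generating step of the DRPC
-- set has a functional term in its frontier.  Hence, up to the second ρ-trigger (ρ , τ), every
-- functional term contains a Skolem term p v of the initial one, and the set T of these terms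
-- contains no other Skolem term of ρ.
--
-- Take as database body and head of ρ with all variables read as distinct constants.  The derivation
-- up to (ρ , τ) is replayed under maps G: first G maps p v to the constant of v, then each c_x is
-- sent to the previous image of τ(x), and so on.  Each G is injective on T, and no image of a constant
-- contains an image of a functional term: otherwise some τ(x) would contain the Skolem term of
-- (ρ , τ) itself.  For such G and a trigger μ, the inverse h of G on skel(μ), with ⋆ elsewhere, maps
-- every chase that has not applied G μ into O(R, μ); as μ is star-unblockable, G μ is then not
-- obsolete.  So the leaf reached by always taking the first disjunct contains all the replays, whose
-- terms grow without bound.

open import Defs
open import Data.Nat using (ℕ; zero; suc; _+_; _≤_; _<_; z≤n; s≤s; _≟_)
open import Data.Nat.Properties
  using (≤-refl; ≤-trans; <-irrefl; <-trans; m≤m+n; m≤n+m; m≤n⇒m≤1+n; suc-injective)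
open import Data.Fin using (zero)
open import Data.List
  using (List; []; _∷_; _++_; map; concat; concatMap; length; deduplicate)
open import Data.List.Properties using (map-∘; map-cong-local; map-id-local; length-map; ∷-injective)
import Data.List.Properties as List
import Data.List.NonEmpty as L⁺
open import Data.List.Membership.Propositional using (_∈_; _∉_; find; lose)
open import Data.List.Membership.Propositional.Properties
  using (∈-map⁺; ∈-map⁻; ∈-++⁺ˡ; ∈-++⁺ʳ; ∈-++⁻; ∈-concatMap⁺; ∈-concatMap⁻; ∈-filter⁺; ∈-filter⁻;
         ∈-deduplicate⁺; ∈-deduplicate⁻)
open import Data.List.Membership.DecPropositional _≟_ using (_∈?_)
open import Data.List.Relation.Unary.All as All using (All; []; _∷_)
open import Data.List.Relation.Unary.All.Properties using (¬All⇒Any¬)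
open import Data.List.Relation.Unary.Any as Any using (Any; here; there; any?)
open import Data.List.Relation.Unary.Any.Properties using () renaming (map⁺ to any-map⁺)
open import Data.List.Relation.Unary.Unique.Propositional using (Unique; []; _∷_)
open import Data.List.Relation.Unary.Unique.DecPropositional.Properties _≟_
  using (deduplicate-!; filter⁺)
open import Data.Maybe using (Maybe; just; nothing; maybe′)
open import Data.Vec as Vec using (Vec; toList; []; _∷_)
import Data.Vec.Properties as Vec
import Data.Vec.Relation.Unary.All as VAll
open import Data.Vec.Relation.Binary.Pointwise.Inductive using (Pointwise; []; _∷_)
open import Data.Product using (∃; ∃-syntax; _×_; _,_; proj₁; proj₂)
import Data.Product.Properties as Product
open import Data.Sum using (_⊎_; inj₁; inj₂)
open import Data.Empty using (⊥; ⊥-elim)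
open import Function using (_∘_; id)
open import Relation.Binary using (DecidableEquality)
open import Relation.Nullary using (¬_; Dec; yes; no)
open import Relation.Nullary.Decidable using (map′; _×-dec_)
open import Relation.Binary.PropositionalEquality
  using (_≡_; _≢_; refl; sym; trans; cong; cong₂)
  renaming (subst to transport)

private
  variable
    A B C : Set

-- Decidable equality of predicates, rules and terms.

_≟ᴾ_ : DecidableEquality Pred
mkPred m n ≟ᴾ mkPred m′ n′ =
  map′ (λ { (refl , refl) → refl }) (λ { refl → refl , refl }) (m ≟ m′ ×-dec n ≟ n′)

≡-decᴬ : DecidableEquality A → DecidableEquality (Atom A)
≡-decᴬ _≟′_ (p ⟨ ts ⟩) (q ⟨ us ⟩) with p ≟ᴾ q
... | no p≢q   = no λ { refl → p≢q refl }
... | yes refl = map′ (λ { refl → refl }) (λ { refl → refl }) (Vec.≡-dec _≟′_ ts us)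

_≟ᴿ_ : DecidableEquality Rule
mkRule b (h L⁺.∷ hs) ≟ᴿ mkRule b′ (h′ L⁺.∷ hs′) =
  map′ (λ { (refl , refl , refl) → refl }) (λ { refl → refl , refl , refl })
       (atoms? b b′ ×-dec atoms? h h′ ×-dec List.≡-dec atoms? hs hs′)
  where atoms? = List.≡-dec (≡-decᴬ _≟_)

_≟ᶜ_ : DecidableEquality Const
nat m ≟ᶜ nat n = map′ (cong nat) (λ { refl → refl }) (m ≟ n)
nat _ ≟ᶜ ⋆     = no λ ()
⋆     ≟ᶜ nat _ = no λ ()
⋆     ≟ᶜ ⋆     = yes refl

_≟ᶠ_ : DecidableEquality FunSym
_≟ᶠ_ = Product.≡-dec _≟ᴿ_ (Product.≡-dec _≟_ _≟_)

mutual
  _≟ᵀ_ : DecidableEquality Term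
  const c ≟ᵀ const d = map′ (cong const) (λ { refl → refl }) (c ≟ᶜ d)
  const _ ≟ᵀ fn _ _  = no λ ()
  fn _ _  ≟ᵀ const _ = no λ ()
  fn f ss ≟ᵀ fn g ts =
    map′ (λ { (refl , refl) → refl }) (λ { refl → refl , refl }) (f ≟ᶠ g ×-dec ss ≟ᵀˢ ts)

  _≟ᵀˢ_ : DecidableEquality (List Term)
  []       ≟ᵀˢ []       = yes refl
  []       ≟ᵀˢ (_ ∷ _)  = no λ ()
  (_ ∷ _)  ≟ᵀˢ []       = no λ ()
  (s ∷ ss) ≟ᵀˢ (t ∷ ts) =
    map′ (λ { (refl , refl) → refl }) (λ { refl → refl , refl }) (s ≟ᵀ t ×-dec ss ≟ᵀˢ ts)

-- Lists and atoms

map-local : {f g : A → B} (xs : List A) → (∀ x → x ∈ xs → f x ≡ g x) → map f xs ≡ map g xs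
map-local xs f≗g = map-cong-local (All.tabulate (f≗g _))

map-local⁻ : {f g : A → B} (xs : List A) → map f xs ≡ map g xs → ∀ x → x ∈ xs → f x ≡ g x
map-local⁻ (_ ∷ _)  eq _ (here refl) = proj₁ (∷-injective eq)
map-local⁻ (_ ∷ xs) eq y (there y∈)  = map-local⁻ xs (proj₂ (∷-injective eq)) y y∈

terms : Atom A → List A
terms a = toList (args a)

mapAtom-∘ : (f : B → C) (g : A → B) (a : Atom A) → mapAtom f (mapAtom g a) ≡ mapAtom (f ∘ g) a
mapAtom-∘ f g (p ⟨ ts ⟩) = cong (p ⟨_⟩) (sym (Vec.map-∘ f g ts))

vmap-local : ∀ {n} {f g : A → B} (xs : Vec A n) → (∀ x → x ∈ toList xs → f x ≡ g x) →
             Vec.map f xs ≡ Vec.map g xs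
vmap-local []       f≗g = refl
vmap-local (x ∷ xs) f≗g =
  cong₂ _∷_ (f≗g x (here refl)) (vmap-local xs (λ y → f≗g y ∘ there))

mapAtom-local : {f g : A → B} (a : Atom A) → (∀ x → x ∈ terms a → f x ≡ g x) →
                mapAtom f a ≡ mapAtom g a
mapAtom-local (p ⟨ ts ⟩) f≗g = cong (p ⟨_⟩) (vmap-local ts f≗g)

pointwise-map : ∀ {n} {R : B → C → Set} {f : A → B} {g : A → C} (xs : Vec A n) →
                (∀ x → x ∈ toList xs → R (f x) (g x)) → Pointwise R (Vec.map f xs) (Vec.map g xs)
pointwise-map []       r = []
pointwise-map (x ∷ xs) r = r x (here refl) ∷ pointwise-map xs (λ y → r y ∘ there)

vall-map : ∀ {n} {P : B → Set} {f : A → B} (xs : Vec A n) → (∀ x → x ∈ toList xs → P (f x)) →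
           VAll.All P (Vec.map f xs)
vall-map []       r = VAll.[]
vall-map (x ∷ xs) r = r x (here refl) VAll.∷ vall-map xs (λ y → r y ∘ there)

∈-terms-map⁻ : {f : A → B} {t : B} (a : Atom A) → t ∈ terms (mapAtom f a) →
               ∃[ x ] (x ∈ terms a × t ≡ f x)
∈-terms-map⁻ {f = f} {t} (p ⟨ ts ⟩) t∈ = ∈-map⁻ f (transport (t ∈_) (Vec.toList-map f ts) t∈)

∈-terms-map⁺ : (f : A → B) {x : A} (a : Atom A) → x ∈ terms a → f x ∈ terms (mapAtom f a)
∈-terms-map⁺ f (p ⟨ ts ⟩) x∈ = transport (f _ ∈_) (sym (Vec.toList-map f ts)) (∈-map⁺ f x∈)

∈-atomsVars⁺ : ∀ {v a as} → a ∈ as → v ∈ terms a → v ∈ atomsVars as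
∈-atomsVars⁺ a∈ v∈ = ∈-concatMap⁺ _ (lose a∈ v∈)

∈-atomsVars⁻ : ∀ {v} as → v ∈ atomsVars as → ∃[ a ] (a ∈ as × v ∈ terms a)
∈-atomsVars⁻ as v∈ = find (∈-concatMap⁻ _ v∈)

-- Rules and skolemised heads

nth⊆concat : ∀ hs i {a} → a ∈ nth hs i → a ∈ concat hs
nth⊆concat (h ∷ hs) zero    a∈ = ∈-++⁺ˡ a∈
nth⊆concat (h ∷ hs) (suc i) a∈ = ∈-++⁺ʳ h (nth⊆concat hs i a∈)

headN-vars : ∀ ψ {i a v} → a ∈ headN ψ i → v ∈ terms a → v ∈ allHeadVars ψ
headN-vars ψ {i} a∈ v∈ = ∈-atomsVars⁺ (nth⊆concat (headList ψ) i a∈) v∈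

0<branching : ∀ ψ → 0 < branching ψ
0<branching (mkRule _ (_ L⁺.∷ _)) = s≤s z≤n

deterministic-head : ∀ ψ → Deterministic ψ → concat (headList ψ) ≡ headN ψ 0
deterministic-head (mkRule _ (h L⁺.∷ [])) refl = List.++-identityʳ h

deterministic-vars : ∀ ψ {v} → Deterministic ψ → v ∈ allHeadVars ψ → v ∈ atomsVars (headN ψ 0)
deterministic-vars ψ det = transport (λ as → _ ∈ atomsVars as) (deterministic-head ψ det)

frontier⁺ : ∀ ψ {v} → v ∈ bodyVars ψ → v ∈ allHeadVars ψ → v ∈ frontier ψ
frontier⁺ ψ v∈b v∈h = ∈-filter⁺ (_∈? allHeadVars ψ) (∈-deduplicate⁺ _≟_ v∈b) v∈h

frontier⁻ : ∀ ψ {v} → v ∈ frontier ψ → v ∈ bodyVars ψ × v ∈ allHeadVars ψ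
frontier⁻ ψ v∈ with ∈-filter⁻ (_∈? allHeadVars ψ) {xs = deduplicate _≟_ (bodyVars ψ)} v∈
... | v∈d , v∈h = ∈-deduplicate⁻ _≟_ (bodyVars ψ) v∈d , v∈h

frontier-unique : ∀ ψ → Unique (frontier ψ)
frontier-unique ψ = filter⁺ (_∈? allHeadVars ψ) (deduplicate-! (bodyVars ψ))

skSubst-body : ∀ ψ {σ i v} → v ∈ bodyVars ψ → skSubst ψ σ i v ≡ σ v
skSubst-body ψ {v = v} v∈ with v ∈? bodyVars ψ
... | yes _ = refl
... | no v∉ = ⊥-elim (v∉ v∈)

skSubst-∃ : ∀ ψ {σ i v} → v ∉ bodyVars ψ → skSubst ψ σ i v ≡ fn (ψ , i , v) (map σ (frontier ψ))
skSubst-∃ ψ {v = v} v∉ with v ∈? bodyVars ψ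
... | yes v∈ = ⊥-elim (v∉ v∈)
... | no _   = refl

skSubst-local : ∀ ψ {σ σ′ i v} → (∀ x → x ∈ frontier ψ → σ x ≡ σ′ x) → v ∈ allHeadVars ψ →
                skSubst ψ σ i v ≡ skSubst ψ σ′ i v
skSubst-local ψ {v = v} eq v∈ with v ∈? bodyVars ψ
... | yes v∈b = eq v (frontier⁺ ψ v∈b v∈)
... | no _    = cong (fn _) (map-local (frontier ψ) eq)

outN-local : ∀ ψ {σ σ′} i → (∀ x → x ∈ frontier ψ → σ x ≡ σ′ x) → outN ψ σ i ≡ outN ψ σ′ i
outN-local ψ i eq = map-local (headN ψ i) λ a a∈ →
  mapAtom-local a λ v v∈ → skSubst-local ψ eq (headN-vars ψ {i} a∈ v∈)

∈-outN-terms⁺ : ∀ ψ σ i {v} → v ∈ atomsVars (headN ψ i) →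
                ∃[ a ] (a ∈ outN ψ σ i × skSubst ψ σ i v ∈ terms a)
∈-outN-terms⁺ ψ σ i v∈ with ∈-atomsVars⁻ (headN ψ i) v∈
... | a , a∈ , v∈a = _ , ∈-map⁺ _ a∈ , ∈-terms-map⁺ (skSubst ψ σ i) a v∈a

data OutTerm (ψ : Rule) (σ : Subst) (i : ℕ) : Term → Set where
  frontier-term : ∀ {x} → x ∈ frontier ψ → OutTerm ψ σ i (σ x)
  skolem-term   : ∀ {v} → v ∈ atomsVars (headN ψ i) → v ∉ bodyVars ψ →
                  OutTerm ψ σ i (fn (ψ , i , v) (map σ (frontier ψ)))

skSubst-outTerm : ∀ ψ {σ i a v} → a ∈ headN ψ i → v ∈ terms a → OutTerm ψ σ i (skSubst ψ σ i v)
skSubst-outTerm ψ {i = i} {v = v} a∈ v∈ with v ∈? bodyVars ψ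
... | yes v∈b = frontier-term (frontier⁺ ψ v∈b (headN-vars ψ {i} a∈ v∈))
... | no v∉b  = skolem-term (∈-atomsVars⁺ a∈ v∈) v∉b

outTerm : ∀ ψ {σ i a t} → a ∈ outN ψ σ i → t ∈ terms a → OutTerm ψ σ i t
outTerm ψ {σ} {i} a∈ t∈ with ∈-map⁻ _ a∈
... | b , b∈ , refl with ∈-terms-map⁻ {f = skSubst ψ σ i} b t∈
... | v , v∈ , refl = skSubst-outTerm ψ b∈ v∈

predOf-body : ∀ {R ψ a} → ψ ∈ R → a ∈ body ψ → PredOf R (pred a)
predOf-body ψ∈ a∈ = lose ψ∈ (∈-map⁺ pred (∈-++⁺ˡ a∈))

predOf-head : ∀ {R ψ i a} → ψ ∈ R → a ∈ headN ψ i → PredOf R (pred a)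
predOf-head {ψ = ψ} {i} ψ∈ a∈ =
  lose ψ∈ (∈-map⁺ pred (∈-++⁺ʳ (body ψ) (nth⊆concat (headList ψ) i a∈)))

datalog? : ∀ ψ → Deterministic ψ →
           Datalog ψ ⊎ ∃[ v ] (v ∈ atomsVars (headN ψ 0) × v ∉ bodyVars ψ)
datalog? ψ det with All.all? (_∈? bodyVars ψ) (allHeadVars ψ)
... | yes all = inj₁ (det , λ v → All.lookup all)
... | no ¬all with find (¬All⇒Any¬ (_∈? bodyVars ψ) _ ¬all)
... | v , v∈ , v∉ = inj₂ (v , deterministic-vars ψ det v∈ , v∉)

datalog-vars : ∀ ψ {v} → Datalog ψ → v ∈ atomsVars (headN ψ 0) → v ∈ bodyVars ψ
datalog-vars ψ (_ , ⊆) v∈ with ∈-atomsVars⁻ (headN ψ 0) v∈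
... | a , a∈ , v∈a = ⊆ _ (headN-vars ψ {0} a∈ v∈a)

τFrom-frontier : ∀ {xs ss} → Unique xs → length ss ≡ length xs → map (τFrom xs ss) xs ≡ ss
τFrom-frontier {[]}     {[]}     _        _   = refl
τFrom-frontier {x ∷ xs} {s ∷ ss} (x∉ ∷ u) len =
  cong₂ _∷_ τx (trans (map-local xs τxs) (τFrom-frontier u (suc-injective len)))
  where
  τx : τFrom (x ∷ xs) (s ∷ ss) x ≡ s
  τx with x ≟ x
  ... | yes _  = refl
  ... | no x≢x = ⊥-elim (x≢x refl)
  τxs : ∀ y → y ∈ xs → τFrom (x ∷ xs) (s ∷ ss) y ≡ τFrom xs ss y
  τxs y y∈ with y ≟ x
  ... | yes refl = ⊥-elim (All.lookup x∉ y∈ refl)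
  ... | no _     = refl

-- Terms

data IsFn : Term → Set where
  isFn : ∀ {f ss} → IsFn (fn f ss)

isFn? : ∀ t → Dec (IsFn t)
isFn? (const _) = no λ ()
isFn? (fn _ _)  = yes isFn

¬isFn⇒const : ∀ {t} → ¬ IsFn t → ∃[ c ] (t ≡ const c)
¬isFn⇒const {const c} _  = c , refl
¬isFn⇒const {fn _ _}  ¬f = ⊥-elim (¬f isFn)

mutual
  size : Term → ℕ
  size (const _) = 0
  size (fn _ ss) = suc (sizes ss)

  sizes : List Term → ℕ
  sizes []       = 0
  sizes (s ∷ ss) = size s + sizes ss

∈⇒size≤ : ∀ {s ss} → s ∈ ss → size s ≤ sizes ss
∈⇒size≤ {ss = s ∷ ss} (here refl) = m≤m+n (size s) (sizes ss)
∈⇒size≤ {ss = s ∷ ss} (there s∈)  = ≤-trans (∈⇒size≤ s∈) (m≤n+m (sizes ss) (size s))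

⊑⇒size≤ : ∀ {s t} → s ⊑ t → size s ≤ size t
⊑⇒size≤ ⊑-refl        = ≤-refl
⊑⇒size≤ (⊑-arg s∈ s⊑) = m≤n⇒m≤1+n (≤-trans (⊑⇒size≤ s⊑) (∈⇒size≤ s∈))

⊑-trans : ∀ {s t u} → s ⊑ t → t ⊑ u → s ⊑ u
⊑-trans s⊑t ⊑-refl          = s⊑t
⊑-trans s⊑t (⊑-arg t∈ t⊑u) = ⊑-arg t∈ (⊑-trans s⊑t t⊑u)

⊑-reflexive : ∀ {s t} → s ≡ t → s ⊑ t
⊑-reflexive refl = ⊑-refl

⊑const⇒≡ : ∀ {t c} → t ⊑ const c → t ≡ const c
⊑const⇒≡ ⊑-refl = refl

⊑fn⁻ : ∀ {t f ss} → t ⊑ fn f ss → t ≡ fn f ss ⊎ Any (t ⊑_) ss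
⊑fn⁻ ⊑-refl        = inj₁ refl
⊑fn⁻ (⊑-arg s∈ t⊑) = inj₂ (lose s∈ t⊑)

fn-injective : ∀ {f g ss ts} → fn f ss ≡ fn g ts → f ≡ g × ss ≡ ts
fn-injective refl = refl , refl

const≢fn : ∀ {c f ss} → Term.const c ≢ fn f ss
const≢fn ()

fn-cong : ∀ {f g ss ts} {us vs : List Term} → f ≡ g × us ≡ vs → (us ≡ vs → ss ≡ ts) →
          fn f ss ≡ fn g ts
fn-cong (refl , eq) inj = cong (fn _) (inj eq)

-- The largest terms of an output are its Skolem terms, so the output determines them.
sameSet⇒frontier≡ : ∀ ψ {σ σ′ v} → v ∈ atomsVars (headN ψ 0) → v ∉ bodyVars ψ →
                    SameSet (outN ψ σ 0) (outN ψ σ′ 0) → ∀ x → x ∈ frontier ψ → σ x ≡ σ′ x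
sameSet⇒frontier≡ ψ {σ} {σ′} {v} v∈ v∉ (σ⊆σ′ , σ′⊆σ) = args≡ (there-term σ⊆σ′) (there-term σ′⊆σ)
  where
  sk : Subst → Term
  sk ς = fn (ψ , 0 , v) (map ς (frontier ψ))
  there-term : ∀ {ς ς′} → (∀ a → a ∈ outN ψ ς 0 → a ∈ outN ψ ς′ 0) → OutTerm ψ ς′ 0 (sk ς)
  there-term {ς} ⊆ with ∈-outN-terms⁺ ψ ς 0 v∈
  ... | a , a∈ , t∈ = outTerm ψ (⊆ a a∈) (transport (_∈ terms a) (skSubst-∃ ψ v∉) t∈)
  smaller : ∀ {x} (ς : Subst) → x ∈ frontier ψ → size (ς x) < suc (sizes (map ς (frontier ψ)))
  smaller ς x∈ = s≤s (∈⇒size≤ (∈-map⁺ ς x∈))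
  args≡ : ∀ {ς ς′} → OutTerm ψ ς′ 0 (sk ς) → OutTerm ψ ς 0 (sk ς′) →
          ∀ x → x ∈ frontier ψ → ς x ≡ ς′ x
  args≡ {ς} {ς′} p q = go p refl q refl
    where
    go : ∀ {s t} → OutTerm ψ ς′ 0 s → s ≡ sk ς → OutTerm ψ ς 0 t → t ≡ sk ς′ →
         ∀ x → x ∈ frontier ψ → ς x ≡ ς′ x
    go (skolem-term _ _) e _ _ = map-local⁻ (frontier ψ) (proj₂ (fn-injective (sym e)))
    go _ _ (skolem-term _ _) e = map-local⁻ (frontier ψ) (proj₂ (fn-injective e))
    -- Each Skolem term would be a frontier value, hence a proper argument, of the other one, so
    -- each would be strictly smaller than the other.
    go (frontier-term x∈) e (frontier-term y∈) e′ = ⊥-elim (<-irrefl refl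
      (<-trans (transport (_< suc (sizes (map ς′ (frontier ψ)))) (cong size e) (smaller ς′ x∈))
               (transport (_< suc (sizes (map ς (frontier ψ)))) (cong size e′) (smaller ς y∈))))

allConst⇒O : ∀ {R μ p n} {f : A → Term} → PredOf R (mkPred p n) → (vs : Vec A n) →
             (∀ v → v ∈ toList vs → ¬ IsFn (f v)) →
             (∀ v → v ∈ toList vs → InSkel μ (f v) ⊎ f v ≡ const ⋆) →
             O R μ (mkPred p n ⟨ Vec.map f vs ⟩)
allConst⇒O {μ = μ} {f = f} p∈ vs c k = o-base p∈ (vall-map vs star)
  where
  star : ∀ v → v ∈ toList vs → ConstSkelStar μ (f v)
  star v v∈ with k v v∈
  ... | inj₂ eq = inj₁ eq
  ... | inj₁ sk with ¬isFn⇒const (c v v∈)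
  ... | d , eq = inj₂ (d , eq , sk)

-- If all frontier terms were constants, sending the existential variables to ⋆ would satisfy the
-- head inside o-base.
unblockable⇒functional : ∀ {R} μ → rule μ ∈ R → ¬ Obsolete (O R μ) μ →
                         Any (IsFn ∘ subst μ) (frontier (rule μ))
unblockable⇒functional {R} (trig ψ σ) ψ∈ ¬obs with any? (isFn? ∘ σ) (frontier ψ)
... | yes any = any
... | no ¬any = ⊥-elim (¬obs (0 , 0<branching ψ , σ⋆ , agree , All.tabulate λ {a} → sat a))
  where
  σ⋆ : Subst
  σ⋆ v with v ∈? bodyVars ψ
  ... | yes _ = σ v
  ... | no _  = const ⋆
  agree : ∀ x → x ∈ bodyVars ψ → σ⋆ x ≡ σ x
  agree x x∈ with x ∈? bodyVars ψ
  ... | yes _ = refl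
  ... | no x∉ = ⊥-elim (x∉ x∈)
  consts : ∀ {v} → v ∈ frontier ψ → ¬ IsFn (σ v)
  consts v∈ f = ¬any (lose v∈ f)
  sat : ∀ a → a ∈ headN ψ 0 → O R (trig ψ σ) (mapAtom σ⋆ a)
  sat (p ⟨ vs ⟩) a∈ = allConst⇒O (predOf-head {i = 0} ψ∈ a∈) vs isConst inSkel
    where
    front : ∀ {v} → v ∈ toList vs → v ∈ bodyVars ψ → v ∈ frontier ψ
    front v∈ v∈b = frontier⁺ ψ v∈b (headN-vars ψ {0} a∈ v∈)
    isConst : ∀ v → v ∈ toList vs → ¬ IsFn (σ⋆ v)
    isConst v v∈ with v ∈? bodyVars ψ
    ... | yes v∈b = consts (front v∈ v∈b)
    ... | no _    = λ ()
    inSkel : ∀ v → v ∈ toList vs → InSkel (trig ψ σ) (σ⋆ v) ⊎ σ⋆ v ≡ const ⋆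
    inSkel v v∈ with v ∈? bodyVars ψ
    ... | no _    = inj₂ refl
    ... | yes v∈b with ¬isFn⇒const (consts (front v∈ v∈b))
    ... | c , eq = inj₁ (inj₂ (c , eq , v , front v∈ v∈b , refl))

-- Terms derivable from the initial trigger, and their birth facts.

birthTerm : Term → Term → Set
birthTerm t s = Any (λ a → s ∈ terms a) (birth t)

∈-births⁺ : ∀ {s ss a} → s ∈ ss → a ∈ birth s → a ∈ births ss
∈-births⁺ (here refl) a∈ = ∈-++⁺ˡ a∈
∈-births⁺ {ss = s ∷ _} (there s∈) a∈ = ∈-++⁺ʳ (birth s) (∈-births⁺ s∈ a∈)

module Prefix (R : List Rule) (ρ : Rule) (ρ∈R : ρ ∈ R) (det : Deterministic ρ)
              (¬datalog : ¬ Datalog ρ) where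

  p : Var → Term
  p v = fn (ρ , 0 , v) (map σuc (frontier ρ))

  ExVar : Var → Set
  ExVar v = v ∈ atomsVars (headN ρ 0) × v ∉ bodyVars ρ

  -- The condition `ψ ≢ ρ` in `other` leaves the `p v` as the only Skolem terms of `ρ` in `T`; the
  -- functional argument demanded there makes every functional term reach down to some `p v`.
  data Kind (ψ : Rule) (ss : List Term) : Set where
    initial : ψ ≡ ρ → ss ≡ map σuc (frontier ρ) → Kind ψ ss
    other   : ψ ≢ ρ → Any IsFn ss → Kind ψ ss

  -- The terms derivable from the initial trigger (ρ , σuc) without a further ρ-trigger; each
  -- functional one contains some p v, because a star-unblockable generating trigger has a
  -- functional term in its frontier.
  data T : Term → Set where
    t-const : ∀ {x} → x ∈ bodyVars ρ → T (const (nat x))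
    t-fn    : ∀ {ψ v ss} → ψ ∈ R → Deterministic ψ → v ∈ atomsVars (headN ψ 0) → v ∉ bodyVars ψ →
              length ss ≡ length (frontier ψ) → All T ss → Kind ψ ss → T (fn (ψ , 0 , v) ss)

  σuc-T : All T (map σuc (frontier ρ))
  σuc-T = All.tabulate λ s∈ → case (∈-map⁻ σuc s∈)
    where
    case : ∀ {s} → ∃[ x ] (x ∈ frontier ρ × s ≡ σuc x) → T s
    case (x , x∈ , refl) = t-const (proj₁ (frontier⁻ ρ x∈))

  p-T : ∀ {v} → ExVar v → T (p v)
  p-T (v∈ , v∉) = t-fn ρ∈R det v∈ v∉ (length-map σuc (frontier ρ)) σuc-T (initial refl refl)

  ¬fn-σuc : ¬ Any IsFn (map σuc (frontier ρ))
  ¬fn-σuc any with find any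
  ... | _ , s∈ , f with ∈-map⁻ σuc s∈
  ¬fn-σuc any | _ , s∈ , () | _ , _ , refl

  exVar : ∃ ExVar
  exVar with datalog? ρ det
  ... | inj₁ d = ⊥-elim (¬datalog d)
  ... | inj₂ e = e

  mutual
    T⇒OverSk : ∀ {t} → T t → OverSk R t
    T⇒OverSk (t-const _) = ov-const _
    T⇒OverSk (t-fn ψ∈ d v∈ v∉ len Ts _) =
      ov-fn ψ∈ (transport (0 <_) (sym d) (s≤s z≤n)) v∈ v∉ len (Ts⇒OverSk Ts)

    Ts⇒OverSk : ∀ {ts} → All T ts → All (OverSk R) ts
    Ts⇒OverSk []       = []
    Ts⇒OverSk (t ∷ ts) = T⇒OverSk t ∷ Ts⇒OverSk ts

  fn-sibling : ∀ {ψ v w ss} → T (fn (ψ , 0 , v) ss) → w ∈ atomsVars (headN ψ 0) →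
               w ∉ bodyVars ψ → T (fn (ψ , 0 , w) ss)
  fn-sibling (t-fn ψ∈ d _ _ len Ts k) w∈ w∉ = t-fn ψ∈ d w∈ w∉ len Ts k

  τFrom-args : ∀ {ψ v ss} → T (fn (ψ , 0 , v) ss) →
               map (τFrom (frontier ψ) ss) (frontier ψ) ≡ ss
  τFrom-args {ψ} (t-fn _ _ _ _ len _ _) = τFrom-frontier (frontier-unique ψ) len

  out⊆birth : ∀ {ψ v ss σ a} → T (fn (ψ , 0 , v) ss) → map σ (frontier ψ) ≡ ss →
              a ∈ outN ψ σ 0 → a ∈ birth (fn (ψ , 0 , v) ss)
  out⊆birth {ψ} t eq a∈ = ∈-++⁺ˡ (transport (_ ∈_)
    (outN-local ψ 0 (map-local⁻ (frontier ψ) (trans eq (sym (τFrom-args t))))) a∈)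

  birth-self : ∀ {f ss} → T (fn f ss) → birthTerm (fn f ss) (fn f ss)
  birth-self t@(t-fn {ψ} {v} {ss} _ _ v∈ v∉ _ _ _)
    with ∈-outN-terms⁺ ψ (τFrom (frontier ψ) ss) 0 v∈
  ... | a , a∈ , t∈ = lose (∈-++⁺ˡ a∈) (transport (_∈ terms a)
    (trans (skSubst-∃ ψ v∉) (cong (fn _) (τFrom-args t))) t∈)

  -- `ψ` is deterministic, so each frontier variable occurs in head 0 and its value is mentioned by
  -- the output that created the term.
  birth-arg : ∀ {f ss s} → T (fn f ss) → s ∈ ss → birthTerm (fn f ss) s
  birth-arg t@(t-fn {ψ} {v} {ss} _ d _ _ _ _ _) s∈
    with ∈-map⁻ _ (transport (_ ∈_) (sym (τFrom-args t)) s∈)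
  ... | x , x∈ , refl with frontier⁻ ψ x∈
  ... | x∈b , x∈h with ∈-outN-terms⁺ ψ (τFrom (frontier ψ) ss) 0 (deterministic-vars ψ d x∈h)
  ... | a , a∈ , t∈ = lose (∈-++⁺ˡ a∈) (transport (_∈ terms a) (skSubst-body ψ x∈b) t∈)

  outTerm-birth : ∀ {ψ v ss s} → T (fn (ψ , 0 , v) ss) →
                  OutTerm ψ (τFrom (frontier ψ) ss) 0 s →
                  s ∈ ss ⊎ ∃[ w ] (T (fn (ψ , 0 , w) ss) × s ≡ fn (ψ , 0 , w) ss)
  outTerm-birth {ψ} {ss = ss} t (frontier-term {x} x∈) =
    inj₁ (transport (τFrom (frontier ψ) ss x ∈_) (τFrom-args t) (∈-map⁺ _ x∈))
  outTerm-birth t (skolem-term {w} w∈ w∉) =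
    inj₂ (w , fn-sibling t w∈ w∉ , cong (fn _) (τFrom-args t))

  mutual
    -- Closure properties of the skeleton rest on this. A term of the output that creates `t` is an
    -- argument of `t` or a Skolem term of the same trigger; older facts are handled by recursion on
    -- the arguments.
    birth-T : ∀ {t s} → T t → birthTerm t s → T s × (∀ {a} → a ∈ birth s → a ∈ birth t)
    birth-T (t-const _) ()
    birth-T t@(t-fn {ψ} {v} {ss} _ _ _ _ _ Ts _) s∈ with find s∈
    ... | b , b∈ , s∈b with ∈-++⁻ (outN ψ (τFrom (frontier ψ) ss) 0) b∈
    ... | inj₂ b∈ss with births-T Ts b∈ss s∈b
    ... | s∈T , ⊆ = s∈T , ∈-++⁺ʳ _ ∘ ⊆
    birth-T t@(t-fn {ψ} {v} {ss} _ _ _ _ _ Ts _) s∈ | b , b∈ , s∈b | inj₁ b∈out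
      with outTerm-birth t (outTerm ψ b∈out s∈b)
    ... | inj₁ s∈ss              = All.lookup Ts s∈ss , ∈-++⁺ʳ _ ∘ ∈-births⁺ s∈ss
    -- `birth` does not look at the Skolem variable, so Skolem terms of the same trigger have
    -- literally the same birth facts.
    ... | inj₂ (w , s∈T , refl) = s∈T , id

    births-T : ∀ {ss b s} → All T ss → b ∈ births ss → s ∈ terms b →
               T s × (∀ {a} → a ∈ birth s → a ∈ births ss)
    births-T {u ∷ us} (t ∷ ts) b∈ s∈ with ∈-++⁻ (birth u) b∈
    ... | inj₁ b∈u with birth-T t (lose b∈u s∈)
    ... | s∈T , ⊆ = s∈T , ∈-++⁺ˡ ∘ ⊆
    births-T {u ∷ us} (t ∷ ts) b∈ s∈ | inj₂ b∈us with births-T ts b∈us s∈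
    ... | s∈T , ⊆ = s∈T , ∈-++⁺ʳ (birth u) ∘ ⊆

  -- Replay maps and the chase branch they are compared with.

  -- `hom` is limited to terms with a functional argument because flattening turns the `p v` into
  -- constants; `onInitial` records the two behaviours there: names for the `p v` over fixed
  -- constants, or a homomorphism. `separated` prevents a functional term from hiding inside the
  -- image of a constant.
  record Good (G : Term → Term) : Set where
    field
      injective : ∀ {s t} → T s → T t → G s ≡ G t → s ≡ t
      hom       : ∀ {f ss} → T (fn f ss) → Any IsFn ss → G (fn f ss) ≡ fn f (map G ss)
      separated : ∀ {t x} → T t → IsFn t → x ∈ bodyVars ρ → ¬ (G t ⊑ G (const (nat x)))
      onInitial : ((∀ x → G (const (nat x)) ≡ const (nat x)) × (∀ v → G (p v) ≡ const (nat v)))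
                  ⊎ (∀ v → G (p v) ≡ fn (ρ , 0 , v) (map G (map σuc (frontier ρ))))

    G-fn : ∀ {f g ss us} → T (fn g ss) → G (fn g ss) ≡ fn f us → f ≡ g × us ≡ map G ss
    G-fn t@(t-fn _ _ _ _ _ _ (other _ any)) eq with trans (sym (hom t any)) eq
    ... | refl = refl , refl
    G-fn (t-fn {v = v} _ _ _ _ _ _ (initial refl refl)) eq with onInitial
    ... | inj₂ p≡ with trans (sym (p≡ v)) eq
    ... | refl = refl , refl
    G-fn (t-fn {v = v} _ _ _ _ _ _ (initial refl refl)) eq | inj₁ (_ , p≡)
      with trans (sym (p≡ v)) eq
    ... | ()

  database : Database
  database = map (mapAtom nat) (body ρ ++ headN ρ 0)

  data Chase : List Fact → Set where
    start : Chase (dbFacts database)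
    apply : ∀ {F} ν → Chase F → RTrigger R ν → Loaded (_∈F F) ν → Chase (F ++ out ν 0)

  Closed : List Fact → Set
  Closed F = ∀ ν → rule ν ∈ R → Loaded (_∈F F) ν → Obsolete (_∈F F) ν

  leftmostLeaf : ∀ {F} → FinChaseTree R F → Chase F → ∃[ L ] (Chase L × Closed L)
  leftmostLeaf (leaf closed) c = _ , c , closed
  leftmostLeaf (node ν@(trig (mkRule _ (_ L⁺.∷ _)) _) rt loaded _ _ children) c =
    leftmostLeaf (children zero) (apply ν c rt loaded)

  -- Pulling a chase back into the overapproximation.

  module Blocking {G} (good : Good G) (φ : Rule) (τ : Subst) (φ∈R : φ ∈ R)
                  (φ-det : Deterministic φ) {w} (w∈ : w ∈ atomsVars (headN φ 0))
                  (w∉ : w ∉ bodyVars φ) (τT : ∀ x → x ∈ bodyVars φ → T (τ x)) where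
    open Good good

    μ : Trigger
    μ = trig φ τ

    -- An explicit list for `InSkel μ`, so that preimages under `G` can be searched.
    skelTerms : List Term
    skelTerms = concatMap terms (birthT μ) ++ map τ (frontier φ)

    τT′ : ∀ {x} → x ∈ frontier φ → T (τ x)
    τT′ x∈ = τT _ (proj₁ (frontier⁻ φ x∈))

    birth⊆birthT : ∀ {x a} → x ∈ frontier φ → a ∈ birth (τ x) → a ∈ birthT μ
    birth⊆birthT x∈ a∈ = ∈-concatMap⁺ _ (lose x∈ a∈)

    frontier-skel : ∀ {x} → x ∈ frontier φ → InSkel μ (τ x)
    frontier-skel {x} x∈ = go (τ x) refl
      where
      go : ∀ t → t ≡ τ x → InSkel μ t
      go (const c) eq = inj₂ (c , refl , x , x∈ , sym eq)
      go (fn f ss) eq with find (birth-self (transport T (sym eq) (τT′ x∈)))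
      ... | a , a∈ , t∈ = inj₁ (lose (birth⊆birthT x∈ (transport (λ t → a ∈ birth t) eq a∈)) t∈)

    skelTerms⁻ : ∀ {t} → t ∈ skelTerms → InSkel μ t
    skelTerms⁻ t∈ with ∈-++⁻ (concatMap terms (birthT μ)) t∈
    ... | inj₁ t∈b = inj₁ (∈-concatMap⁻ terms t∈b)
    ... | inj₂ t∈f with ∈-map⁻ τ t∈f
    ... | x , x∈ , refl = frontier-skel x∈

    skelTerms⁺ : ∀ {t} → InSkel μ t → t ∈ skelTerms
    skelTerms⁺ (inj₁ t∈) = ∈-++⁺ˡ (∈-concatMap⁺ terms t∈)
    skelTerms⁺ (inj₂ (_ , _ , x , x∈ , refl)) =
      ∈-++⁺ʳ (concatMap terms (birthT μ)) (∈-map⁺ τ x∈)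

    skel-birth : ∀ {t} → InSkel μ t → T t × (∀ {a} → a ∈ birth t → a ∈ birthT μ)
    skel-birth (inj₁ t∈) with find t∈
    ... | a , a∈ , t∈a with find (∈-concatMap⁻ (λ x → birth (τ x)) a∈)
    ... | x , x∈ , a∈x with birth-T (τT′ x∈) (lose a∈x t∈a)
    ... | tT , ⊆ = tT , birth⊆birthT x∈ ∘ ⊆
    skel-birth (inj₂ (_ , refl , x , x∈ , eq)) = transport T eq (τT′ x∈) , λ ()

    skel-T : ∀ {t} → InSkel μ t → T t
    skel-T = proj₁ ∘ skel-birth

    skel-arg : ∀ {f ss s} → InSkel μ (fn f ss) → s ∈ ss → InSkel μ s
    skel-arg sk s∈ with skel-birth sk
    ... | tT , ⊆ with find (birth-arg tT s∈)
    ... | a , a∈ , s∈a = inj₁ (lose (⊆ a∈) s∈a)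

    skel-p-out : ∀ {v a} → InSkel μ (p v) → a ∈ outN ρ σuc 0 → a ∈ birthT μ
    skel-p-out sk a∈ with skel-birth sk
    ... | pT , ⊆ = ⊆ (out⊆birth pT refl a∈)

    skel-p : ∀ {v u} → InSkel μ (p v) → ExVar u → InSkel μ (p u)
    skel-p sk (u∈ , u∉) with ∈-outN-terms⁺ ρ σuc 0 u∈
    ... | a , a∈ , t∈ =
      inj₁ (lose (skel-p-out sk a∈) (transport (_∈ terms a) (skSubst-∃ ρ u∉) t∈))

    -- The partial inverse of G on skel(μ), extended by ⋆.
    h : Term → Term
    h u with any? (λ t → G t ≟ᵀ u) skelTerms
    ... | yes any = proj₁ (find any)
    ... | no _    = const ⋆

    data HSpec (u : Term) : Term → Set where
      hit  : ∀ {t} → InSkel μ t → G t ≡ u → HSpec u t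
      miss : (∀ {t} → InSkel μ t → G t ≢ u) → HSpec u (const ⋆)

    h-spec : ∀ u → HSpec u (h u)
    h-spec u with any? (λ t → G t ≟ᵀ u) skelTerms
    ... | yes any = let t , t∈ , eq = find any in hit (skelTerms⁻ t∈) eq
    ... | no ¬any = miss λ sk eq → ¬any (lose (skelTerms⁺ sk) eq)

    h-G : ∀ {t} → InSkel μ t → h (G t) ≡ t
    h-G {t} sk with h (G t) | h-spec (G t)
    ... | _ | hit sk′ eq = injective (skel-T sk′) (skel-T sk) eq
    ... | _ | miss ¬eq   = ⊥-elim (¬eq sk refl)

    h-skel : ∀ u → InSkel μ (h u) ⊎ h u ≡ const ⋆
    h-skel u with h u | h-spec u
    ... | _ | hit sk _ = inj₁ sk
    ... | _ | miss _   = inj₂ refl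

    ⋆∉skel : ¬ InSkel μ (const ⋆)
    ⋆∉skel sk with skel-T sk
    ... | ()

    G-h : ∀ {u} → InSkel μ (h u) → G (h u) ≡ u
    G-h {u} sk with h u | h-spec u
    ... | _ | hit _ eq = eq
    ... | _ | miss _   = ⊥-elim (⋆∉skel sk)

    fn-skel : ∀ {u} → IsFn (h u) → InSkel μ (h u)
    fn-skel {u} f with h u | h-spec u
    fn-skel f  | _ | hit sk _ = sk
    fn-skel () | _ | miss _

    h-OverSk : ∀ u → OverSk R (h u)
    h-OverSk u with h-skel u
    ... | inj₁ sk = T⇒OverSk (skel-T sk)
    ... | inj₂ eq = transport (OverSk R) (sym eq) (ov-const ⋆)

    map-G-h : ∀ {us} → (∀ {u} → u ∈ us → InSkel μ (h u)) → map G (map h us) ≡ us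
    map-G-h sk = trans (sym (map-∘ _)) (map-id-local (All.tabulate (G-h ∘ sk)))

    map-h-G : ∀ {ss} → (∀ {s} → s ∈ ss → InSkel μ s) → map h (map G ss) ≡ ss
    map-h-G sk = trans (sym (map-∘ _)) (map-id-local (All.tabulate (h-G ∘ sk)))

    HStar-h : ∀ u → HStar μ (h u) (h u)
    HStar-h u with h-skel u
    ... | inj₁ sk = inj₁ (sk , refl)
    ... | inj₂ eq = inj₂ ((λ sk → ⋆∉skel (transport (InSkel μ) eq sk)) , eq)

    -- `h` commutes with `f` up to the collapse to `⋆`. If `fn f us` has a functional preimage in
    -- the skeleton, `G-fn` and closure under arguments identify it with `fn f (map h us)`; if it
    -- has none at all, `hom` shows that `fn f (map h us)` is outside the skeleton.
    HStar-fn : ∀ f us → Any (IsFn ∘ h) us → HStar μ (fn f (map h us)) (h (fn f us))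
    HStar-fn f us any with h (fn f us) | h-spec (fn f us)
    ... | _ | hit {fn g ss} sk eq with G-fn (skel-T sk) eq
    ... | refl , refl with map-h-G (skel-arg sk)
    ... | eq′ = inj₁ (transport (InSkel μ) (sym s≡) sk , sym s≡)
      where
      s≡ : fn f (map h us) ≡ fn g ss
      s≡ = cong (fn f) eq′
    HStar-fn f us any | _ | hit {const c} sk eq with skel-T sk | find any
    -- The image of a constant would contain `u`, the image of the functional term `h u`.
    ... | t-const x∈ | u , u∈ , isf = ⊥-elim (separated (skel-T (fn-skel isf)) isf x∈
      (transport (G (h u) ⊑_) (sym eq) (⊑-arg (transport (_∈ us) (sym (G-h (fn-skel isf))) u∈) ⊑-refl)))
    HStar-fn f us any | _ | miss ¬eq = inj₂ (notSkel , refl)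
      where
      notSkel : ¬ InSkel μ (fn f (map h us))
      notSkel sk = ¬eq sk (trans (hom (skel-T sk) (any-map⁺ any))
        (cong (fn f) (map-G-h (skel-arg sk ∘ ∈-map⁺ h))))

    Image : List Fact → Set
    Image F = ∀ a → a ∈ F → O R μ (mapAtom h a)

    -- Only the frontier is compared, since it alone determines the outputs. These are the triggers
    -- that `o-out` may refuse.
    Agrees : Trigger → Set
    Agrees (trig ψ υ) = ψ ≡ φ × All (λ x → h (υ x) ≡ τ x) (frontier φ)

    agrees? : ∀ ν → Dec (Agrees ν)
    agrees? (trig ψ υ) = ψ ≟ᴿ φ ×-dec All.all? (λ x → h (υ x) ≟ᵀ τ x) (frontier φ)

    image-loaded : ∀ {F ψ υ} → Image F → Loaded (_∈F F) (trig ψ υ) →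
                   Loaded (O R μ) (trig ψ (h ∘ υ))
    image-loaded {υ = υ} image loaded =
      All.map (λ {a} a∈ → transport (O R μ) (mapAtom-∘ h υ a) (image _ a∈)) loaded

    -- A fact with only constants in its image falls under `o-base`. If some frontier value is
    -- functional under `h`, the trigger translated along `h` is applied by `o-out`, with `HStar-fn`
    -- handling Skolem terms. What remains is a copy of the initial trigger, whose image consists of
    -- birth facts.
    image-step : ∀ {F ψ υ} → ψ ∈ R → Loaded (_∈F F) (trig ψ υ) → ¬ Agrees (trig ψ υ) →
                 Image F → Image (outN ψ υ 0)
    image-step {F} {ψ} {υ} ψ∈ loaded ¬agrees image a a∈ with ∈-map⁻ _ a∈
    ... | b@(q ⟨ vs ⟩) , b∈ , refl =
      transport (O R μ) (sym (mapAtom-∘ h sk b)) (go (any? (isFn? ∘ h ∘ υ) (frontier ψ))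
                                                     (any? (isFn? ∘ h ∘ sk) (toList vs)))
      where
      sk : Subst
      sk = skSubst ψ υ 0

      fresh : ψ ≡ φ → ∃[ i ] (i < branching φ × ¬ SameSet (outN ψ (h ∘ υ) i) (outN φ τ i))
      -- Head 0 suffices: it contains the existential `w`, so equal outputs would force equal
      -- frontier values and hence agreement.
      fresh refl = 0 , 0<branching φ , λ same →
        ¬agrees (refl , All.tabulate (sameSet⇒frontier≡ φ w∈ w∉ same _))

      ¬fn⇒O : ¬ Any (IsFn ∘ h ∘ sk) (toList vs) → O R μ (mapAtom (h ∘ sk) b)
      ¬fn⇒O ¬fn = allConst⇒O (predOf-head {i = 0} ψ∈ b∈) vs (λ v v∈ f → ¬fn (lose v∈ f))
                             (λ v _ → h-skel (sk v))

      star : Any (IsFn ∘ h ∘ υ) (frontier ψ) → ∀ v → v ∈ toList vs →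
             HStar μ (skSubst ψ (h ∘ υ) 0 v) (h (sk v))
      star any v v∈ with v ∈? bodyVars ψ
      ... | yes _ = HStar-h (υ v)
      ... | no _  = transport (λ ts → HStar μ (fn _ ts) (h (fn _ (map υ (frontier ψ)))))
        (sym (map-∘ (frontier ψ))) (HStar-fn _ (map υ (frontier ψ)) (any-map⁺ any))

      -- With a constant frontier a functional image can only be some p v, so the trigger is the
      -- G-image of (ρ , σuc).
      initial-case : ¬ Any (IsFn ∘ h ∘ υ) (frontier ψ) → ∀ {v} → v ∈ toList vs →
                     IsFn (h (sk v)) → O R μ (mapAtom (h ∘ sk) b)
      initial-case ¬any {v} v∈ f with v ∈? bodyVars ψ
      ... | yes v∈b = ⊥-elim (¬any (lose (frontier⁺ ψ v∈b (headN-vars ψ {0} b∈ v∈)) f))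
      ... | no v∉b with h (fn (ψ , 0 , v) (map υ (frontier ψ)))
                      | h-spec (fn (ψ , 0 , v) (map υ (frontier ψ)))
      initial-case ¬any v∈ () | no v∉b | _ | miss _
      initial-case ¬any v∈ () | no v∉b | _ | hit {const _} _ _
      ... | _ | hit {fn g ss} s eq with G-fn (skel-T s) eq
      ... | refl , υ≡ with skel-T s
      ... | t-fn _ _ _ _ _ _ (other _ any) = ⊥-elim (absurd (find any))
        where
        absurd : ¬ (∃[ s ] (s ∈ ss × IsFn s))
        absurd (s′ , s∈ , isf) with ∈-map⁻ υ (transport (_ ∈_) (sym υ≡) (∈-map⁺ G s∈))
        ... | x , x∈ , Gs≡ = ¬any (lose x∈
          (transport IsFn (trans (sym (h-G (skel-arg s s∈))) (cong h Gs≡)) isf))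
      ... | t-fn _ _ _ _ _ _ (initial refl refl) with onInitial
      ... | inj₁ (_ , p≡) = ⊥-elim (const≢fn (trans (sym (p≡ _)) eq))
      ... | inj₂ p≡ = transport (O R μ) (sym (mapAtom-local b inverse))
                                (o-birth (skel-p-out s (∈-map⁺ _ b∈)))
        where
        inverse : ∀ u → u ∈ toList vs → h (sk u) ≡ skSubst ρ σuc 0 u
        inverse u u∈ with u ∈? bodyVars ρ
        ... | yes u∈b = trans
          (cong h (map-local⁻ (frontier ρ) (trans υ≡ (sym (map-∘ _))) u u∈f))
          (h-G (skel-arg s (∈-map⁺ σuc u∈f)))
          where u∈f = frontier⁺ ρ u∈b (headN-vars ρ {0} b∈ u∈)
        ... | no u∉b = trans (cong h (trans (cong (fn _) υ≡) (sym (p≡ u))))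
                             (h-G (skel-p s (∈-atomsVars⁺ b∈ u∈ , u∉b)))

      go : Dec (Any (IsFn ∘ h ∘ υ) (frontier ψ)) → Dec (Any (IsFn ∘ h ∘ sk) (toList vs)) →
           O R μ (mapAtom (h ∘ sk) b)
      go _ (no ¬fn) = ¬fn⇒O ¬fn
      go (yes any) _ = o-out (trig ψ (h ∘ υ)) (ψ∈ , λ x _ → h-OverSk (υ x))
        (image-loaded {ψ = ψ} image loaded) fresh 0 (∈-map⁺ _ b∈) (pointwise-map vs (star any))
      go (no ¬any) (yes some) with find some
      ... | v , v∈ , f = initial-case ¬any v∈ f

    -- `h` can make a database constant functional only if the constant names some `p v`, so
    -- `onInitial` is in its first case. The fact then comes from the head of `ρ`, since `v` is no
    -- body variable, and `h` undoes the naming.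
    image-start : Image (dbFacts database)
    image-start a a∈ with ∈-map⁻ _ a∈
    ... | a′ , a′∈ , refl with ∈-map⁻ _ a′∈
    ... | b@(q ⟨ vs ⟩) , b∈ , refl =
      transport (O R μ) (sym (trans (cong (mapAtom h) (mapAtom-∘ const nat b)) (mapAtom-∘ h σuc b)))
        (go (any? (isFn? ∘ h ∘ σuc) (toList vs)))
      where
      predOf : PredOf R q
      predOf with ∈-++⁻ (body ρ) b∈
      ... | inj₁ b∈b = predOf-body ρ∈R b∈b
      ... | inj₂ b∈h = predOf-head {i = 0} ρ∈R b∈h

      initial-case : ∀ {v} → v ∈ toList vs → IsFn (h (σuc v)) → O R μ (mapAtom (h ∘ σuc) b)
      initial-case {v} v∈ f with h (σuc v) | h-spec (σuc v)
      initial-case v∈ () | _ | miss _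
      initial-case v∈ () | _ | hit {const _} _ _
      ... | _ | hit {fn g ss} s eq with skel-T s
      ... | t@(t-fn _ _ _ _ _ _ (other _ any)) = ⊥-elim (const≢fn (trans (sym eq) (hom t any)))
      ... | t-fn _ _ _ u∉ _ _ (initial refl refl) with onInitial
      ... | inj₂ p≡ = ⊥-elim (const≢fn (trans (sym eq) (p≡ _)))
      ... | inj₁ (c≡ , p≡) with trans (sym (p≡ _)) eq
      ... | refl with ∈-++⁻ (body ρ) b∈
      ... | inj₁ b∈b = ⊥-elim (u∉ (∈-atomsVars⁺ b∈b v∈))
      ... | inj₂ b∈h = transport (O R μ) (sym (mapAtom-local b inverse))
                                 (o-birth (skel-p-out s (∈-map⁺ _ b∈h)))
        where
        inverse : ∀ u → u ∈ toList vs → h (σuc u) ≡ skSubst ρ σuc 0 u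
        inverse u u∈ with u ∈? bodyVars ρ
        ... | yes u∈b = trans (cong h (sym (c≡ u)))
          (h-G (skel-arg s (∈-map⁺ σuc (frontier⁺ ρ u∈b (headN-vars ρ {0} b∈h u∈)))))
        ... | no u∉b = trans (cong h (sym (p≡ u)))
                             (h-G (skel-p s (∈-atomsVars⁺ b∈h u∈ , u∉b)))

      go : Dec (Any (IsFn ∘ h ∘ σuc) (toList vs)) → O R μ (mapAtom (h ∘ σuc) b)
      go (no ¬fn) = allConst⇒O predOf vs (λ v v∈ f → ¬fn (lose v∈ f)) (λ v _ → h-skel (σuc v))
      go (yes some) with find some
      ... | v , v∈ , f = initial-case v∈ f

    Applied : List Fact → Set
    Applied F = ∀ {a} → a ∈ outN φ (G ∘ τ) 0 → a ∈ F

    -- `image-step` carries the invariant along until a step agrees with `μ`. As `G` inverts `h` on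
    -- the skeleton, such a step has exactly the output of the `G`-image of `μ`.
    applied⊎image : ∀ {F} → Chase F → Applied F ⊎ Image F
    applied⊎image start = inj₂ image-start
    applied⊎image (apply {F} ν@(trig ψ υ) c (ψ∈ , _) loaded) with applied⊎image c | agrees? ν
    ... | inj₁ applied | _ = inj₁ (∈-++⁺ˡ ∘ applied)
    ... | inj₂ image | yes (refl , agrees) =
      inj₁ (∈-++⁺ʳ F ∘ transport (_ ∈_) (outN-local φ 0 same))
      where
      same : ∀ x → x ∈ frontier φ → G (τ x) ≡ υ x
      same x x∈ with All.lookup agrees x∈
      ... | eq = trans (cong G (sym eq)) (G-h (transport (InSkel μ) (sym eq) (frontier-skel x∈)))
    ... | inj₂ image | no ¬agrees = inj₂ λ a a∈ → split a (∈-++⁻ F a∈)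
      where
      split : ∀ a → a ∈ F ⊎ a ∈ outN ψ υ 0 → O R μ (mapAtom h a)
      split a (inj₁ a∈) = image a a∈
      split a (inj₂ a∈) = image-step ψ∈ loaded ¬agrees image a a∈

    -- If the image of `μ` were not applied, a witness of its obsolescence in the closed set would
    -- translate along `h` into one for `μ` in `O R μ`.
    forced : ∀ {F} → Chase F → Closed F → Loaded (_∈F F) (trig φ (G ∘ τ)) →
             ¬ Obsolete (O R μ) μ → Applied F
    forced {F} c closed loaded ¬obs with applied⊎image c
    ... | inj₁ applied = applied
    ... | inj₂ image with closed (trig φ (G ∘ τ)) φ∈R loaded
    ... | i , i< , σ′ , agree , sat = ⊥-elim (¬obs (i , i< , σ″ , agree″ , All.tabulate sat″))
      where
      -- Body variables keep `τ`: one outside the frontier may have a value outside the skeleton,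
      -- which `h` need not restore.
      σ″ : Subst
      σ″ v with v ∈? bodyVars φ
      ... | yes _ = τ v
      ... | no _  = h (σ′ v)
      agree″ : ∀ x → x ∈ bodyVars φ → σ″ x ≡ τ x
      agree″ x x∈ with x ∈? bodyVars φ
      ... | yes _ = refl
      ... | no x∉ = ⊥-elim (x∉ x∈)
      sat″ : ∀ {a} → a ∈ headN φ i → O R μ (mapAtom σ″ a)
      sat″ {a} a∈ = transport (O R μ) (trans (mapAtom-∘ h σ′ a) (mapAtom-local a same))
                              (image _ (All.lookup sat a∈))
        where
        same : ∀ v → v ∈ terms a → h (σ′ v) ≡ σ″ v
        same v v∈ with v ∈? bodyVars φ
        ... | yes v∈b = trans (cong h (agree v v∈b))
          (h-G (frontier-skel (frontier⁺ φ v∈b (headN-vars φ {i} a∈ v∈))))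
        ... | no _ = refl

  -- Grafting and flattening.

  mutual
    graft : (Const → Term) → (FunSym → Maybe Term) → Term → Term
    graft γ δ (const c) = γ c
    graft γ δ (fn f ss) = maybe′ id (fn f (grafts γ δ ss)) (δ f)

    grafts : (Const → Term) → (FunSym → Maybe Term) → List Term → List Term
    grafts γ δ []       = []
    grafts γ δ (s ∷ ss) = graft γ δ s ∷ grafts γ δ ss

  grafts≡map : ∀ γ δ ss → grafts γ δ ss ≡ map (graft γ δ) ss
  grafts≡map γ δ []       = refl
  grafts≡map γ δ (s ∷ ss) = cong (_ ∷_) (grafts≡map γ δ ss)

  -- Each p v becomes the constant named v, which is fresh because v is not a body variable.
  flat : FunSym → Maybe Term
  flat (ψ , _ , v) with ψ ≟ᴿ ρ
  ... | yes _ = just (const (nat v))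
  ... | no _  = nothing

  flatten : Term → Term
  flatten = graft const flat

  flatten-ρ : ∀ v ss → flatten (fn (ρ , 0 , v) ss) ≡ const (nat v)
  flatten-ρ v ss with ρ ≟ᴿ ρ
  ... | yes _  = refl
  ... | no ρ≢ρ = ⊥-elim (ρ≢ρ refl)

  flatten-fn : ∀ {ψ i v ss} → ψ ≢ ρ →
               flatten (fn (ψ , i , v) ss) ≡ fn (ψ , i , v) (map flatten ss)
  flatten-fn {ψ} {ss = ss} ψ≢ρ with ψ ≟ᴿ ρ
  ... | yes eq = ⊥-elim (ψ≢ρ eq)
  ... | no _   = cong (fn _) (grafts≡map const flat ss)

  flatten-fn≢body : ∀ {t x} → T t → IsFn t → x ∈ bodyVars ρ → flatten t ≢ const (nat x)
  flatten-fn≢body (t-fn _ _ _ v∉ _ _ (initial refl refl)) _ x∈ eq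
    with trans (sym (flatten-ρ _ _)) eq
  ... | refl = v∉ x∈
  flatten-fn≢body (t-fn _ _ _ _ _ _ (other ψ≢ρ _)) _ x∈ eq
    with trans (sym (flatten-fn ψ≢ρ)) eq
  ... | ()

  mutual
    flatten-injective : ∀ {s t} → T s → T t → flatten s ≡ flatten t → s ≡ t
    flatten-injective (t-const _) (t-const _) refl = refl
    flatten-injective (t-const x∈) t@(t-fn _ _ _ _ _ _ _) eq =
      ⊥-elim (flatten-fn≢body t isFn x∈ (sym eq))
    flatten-injective t@(t-fn _ _ _ _ _ _ _) (t-const x∈) eq =
      ⊥-elim (flatten-fn≢body t isFn x∈ eq)
    flatten-injective (t-fn _ _ _ _ _ _ (initial refl refl))
                      (t-fn _ _ _ _ _ _ (initial refl refl)) eq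
      with trans (sym (flatten-ρ _ _)) (trans eq (flatten-ρ _ _))
    ... | refl = refl
    flatten-injective (t-fn _ _ _ _ _ _ (initial refl refl))
                      (t-fn _ _ _ _ _ _ (other ψ≢ρ _)) eq
      with trans (sym (flatten-ρ _ _)) (trans eq (flatten-fn ψ≢ρ))
    ... | ()
    flatten-injective (t-fn _ _ _ _ _ _ (other ψ≢ρ _))
                      (t-fn _ _ _ _ _ _ (initial refl refl)) eq
      with trans (sym (flatten-fn ψ≢ρ)) (trans eq (flatten-ρ _ _))
    ... | ()
    flatten-injective (t-fn _ _ _ _ _ Ss (other ψ≢ρ _)) (t-fn _ _ _ _ _ Ts (other ψ′≢ρ _)) eq =
      fn-cong (fn-injective (trans (sym (flatten-fn ψ≢ρ)) (trans eq (flatten-fn ψ′≢ρ))))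
              (flattens-injective Ss Ts)

    flattens-injective : ∀ {ss ts} → All T ss → All T ts → map flatten ss ≡ map flatten ts → ss ≡ ts
    flattens-injective []       []       _  = refl
    flattens-injective (s ∷ ss) (t ∷ ts) eq = cong₂ _∷_
      (flatten-injective s t (proj₁ (∷-injective eq)))
      (flattens-injective ss ts (proj₂ (∷-injective eq)))

  flatten-good : Good flatten
  flatten-good = record
    { injective = flatten-injective
    ; hom       = flatten-hom
    ; separated = λ { t f x∈ ⊑-const → flatten-fn≢body t f x∈ (⊑const⇒≡ ⊑-const) }
    ; onInitial = inj₁ ((λ _ → refl) , λ v → flatten-ρ v _)
    }
    where
    flatten-hom : ∀ {f ss} → T (fn f ss) → Any IsFn ss → flatten (fn f ss) ≡ fn f (map flatten ss)
    flatten-hom (t-fn _ _ _ _ _ _ (other ψ≢ρ _))        _   = flatten-fn ψ≢ρ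
    flatten-hom (t-fn _ _ _ _ _ _ (initial refl refl)) any = ⊥-elim (¬fn-σuc any)

  -- Replaces each initial constant c_x by its value under a second ρ-trigger seen through G.
  next : (Term → Term) → Subst → Term → Term
  next G τ = graft γ (λ _ → nothing)
    where
    γ : Const → Term
    γ (nat x) = G (τ x)
    -- A default value: `⋆` does not occur in `T`.
    γ ⋆       = const ⋆

  next-fn : ∀ G τ f ss → next G τ (fn f ss) ≡ fn f (map (next G τ) ss)
  next-fn G τ f ss = cong (fn f) (grafts≡map _ _ ss)

  -- The next replay map inherits the invariants and grows.

  module Next {G} (good : Good G) (τ : Subst) (τT : ∀ x → x ∈ bodyVars ρ → T (τ x))
              (τ-inj : InjectiveOn (bodyVars ρ) τ) (fn∈ : Any (IsFn ∘ τ) (frontier ρ)) where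
    open Good good

    G′ : Term → Term
    G′ = next G τ

    G′-σuc : map G′ (map σuc (frontier ρ)) ≡ map (G ∘ τ) (frontier ρ)
    G′-σuc = sym (map-∘ (frontier ρ))

    q : Var → Term
    q v = fn (ρ , 0 , v) (map (G ∘ τ) (frontier ρ))

    G′-p : ∀ v → G′ (p v) ≡ q v
    G′-p v = trans (next-fn G τ _ _) (cong (fn _) G′-σuc)

    mutual
      p⊑ : ∀ {t} → T t → IsFn t → ∃[ v ] (G′ (p v) ⊑ G′ t)
      p⊑ (t-fn _ _ _ _ _ _ (initial refl refl)) _ = _ , ⊑-refl
      p⊑ (t-fn {ss = ss} _ _ _ _ _ Ts (other _ any)) _ with p⊑-args Ts any
      ... | v , s , s∈ , p⊑s = v , transport (G′ (p v) ⊑_) (sym (next-fn G τ _ ss))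
                                           (⊑-arg (∈-map⁺ G′ s∈) p⊑s)

      p⊑-args : ∀ {ss} → All T ss → Any IsFn ss → ∃[ v ] ∃[ s ] (s ∈ ss × G′ (p v) ⊑ G′ s)
      p⊑-args (t ∷ _) (here f) with p⊑ t f
      ... | v , p⊑s = v , _ , here refl , p⊑s
      p⊑-args (_ ∷ ts) (there any) with p⊑-args ts any
      ... | v , s , s∈ , p⊑s = v , s , there s∈ , p⊑s

    mutual
      -- Since `q v` is `G′ (p v)` and `G′` sends constants to terms `G (τ x)`, this yields
      -- separation for `G′`. Images of constants are excluded by `separated`, as `q v` has a
      -- functional image among its arguments. On `p u`, equality with `q v` would by injectivity
      -- identify a functional `τ w` with a constant; on other terms the head symbol is not from
      -- `ρ`.
      q⋢ : ∀ {t} v → T t → ¬ (q v ⊑ G t)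
      q⋢ v (t-const x∈) p⊑ with find fn∈
      ... | w , w∈ , f = separated (τT w (proj₁ (frontier⁻ ρ w∈))) f x∈
                                   (⊑-trans (⊑-arg (∈-map⁺ (G ∘ τ) w∈) ⊑-refl) p⊑)
      q⋢ v (t-fn {v = u} _ _ _ _ _ Ts (initial refl refl)) p⊑ with onInitial
      ... | inj₁ (_ , p≡) with ⊑const⇒≡ (transport (q v ⊑_) (p≡ u) p⊑)
      ... | ()
      q⋢ v (t-fn {v = u} _ _ _ _ _ Ts (initial refl refl)) p⊑ | inj₂ p≡
        with ⊑fn⁻ (transport (q v ⊑_) (p≡ u) p⊑)
      ... | inj₂ any = qs⋢ v Ts any
      ... | inj₁ eq with find fn∈
      ... | w , w∈ , f = absurd f (injective (τT w w∈b) (t-const w∈b)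
          (map-local⁻ (frontier ρ) (trans (proj₂ (fn-injective eq)) (sym (map-∘ _))) w w∈))
        where
        w∈b = proj₁ (frontier⁻ ρ w∈)
        absurd : ∀ {t c} → IsFn t → t ≢ const c
        absurd () refl
      q⋢ v t@(t-fn _ _ _ _ _ Ts (other ψ≢ρ any)) p⊑ with ⊑fn⁻ (transport (q v ⊑_) (hom t any) p⊑)
      ... | inj₁ eq   = ψ≢ρ (sym (cong proj₁ (proj₁ (fn-injective eq))))
      ... | inj₂ any′ = qs⋢ v Ts any′

      qs⋢ : ∀ {ts} v → All T ts → ¬ Any (q v ⊑_) (map G ts)
      qs⋢ v (t ∷ _)  (here p⊑)   = q⋢ v t p⊑
      qs⋢ v (_ ∷ ts) (there any) = qs⋢ v ts any

    G′-separated : ∀ {t x} → T t → IsFn t → x ∈ bodyVars ρ → ¬ (G′ t ⊑ G′ (const (nat x)))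
    G′-separated t f x∈ t⊑ with p⊑ t f
    ... | v , p⊑t = q⋢ v (τT _ x∈) (⊑-trans (⊑-reflexive (sym (G′-p v))) (⊑-trans p⊑t t⊑))

    mutual
      -- The injectivity of `τ` settles two constants, separation settles mixed pairs, and
      -- functional terms reduce to their arguments.
      G′-injective : ∀ {s t} → T s → T t → G′ s ≡ G′ t → s ≡ t
      G′-injective (t-const x∈) (t-const y∈) eq =
        cong σuc (τ-inj _ _ x∈ y∈ (injective (τT _ x∈) (τT _ y∈) eq))
      G′-injective (t-const x∈) t@(t-fn _ _ _ _ _ _ _) eq =
        ⊥-elim (G′-separated t isFn x∈ (⊑-reflexive (sym eq)))
      G′-injective t@(t-fn _ _ _ _ _ _ _) (t-const x∈) eq =
        ⊥-elim (G′-separated t isFn x∈ (⊑-reflexive eq))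
      G′-injective (t-fn {ss = ss} _ _ _ _ _ Ss _) (t-fn {ss = ts} _ _ _ _ _ Ts _) eq =
        fn-cong (fn-injective (trans (sym (next-fn G τ _ ss)) (trans eq (next-fn G τ _ ts))))
                (G′s-injective Ss Ts)

      G′s-injective : ∀ {ss ts} → All T ss → All T ts → map G′ ss ≡ map G′ ts → ss ≡ ts
      G′s-injective []       []       _  = refl
      G′s-injective (s ∷ ss) (t ∷ ts) eq = cong₂ _∷_
        (G′-injective s t (proj₁ (∷-injective eq)))
        (G′s-injective ss ts (proj₂ (∷-injective eq)))

    next-good : Good G′
    next-good = record
      { injective = G′-injective
      ; hom       = λ _ _ → next-fn G τ _ _
      ; separated = G′-separated
      ; onInitial = inj₂ λ v → next-fn G τ _ _
      }

    -- Some frontier value `τ w` is functional and so contains a `p u`; its `G`-image is an argument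
    -- of `q v`, one function symbol deeper.
    size-next : ∀ v {n} → (∀ u → ExVar u → n ≤ size (G (p u))) → n < size (G′ (p v))
    size-next v {n} n≤ with find fn∈
    ... | w , w∈ , f = transport (λ t → n < size t) (sym (G′-p v))
      (s≤s (≤-trans (size-bound (τT w (proj₁ (frontier⁻ ρ w∈))) f)
                    (∈⇒size≤ (∈-map⁺ (G ∘ τ) w∈))))
      where
      mutual
        size-bound : ∀ {t} → T t → IsFn t → n ≤ size (G t)
        size-bound (t-fn _ _ v∈ v∉ _ _ (initial refl refl)) _ = n≤ _ (v∈ , v∉)
        size-bound t@(t-fn _ _ _ _ _ Ts (other _ any)) _ =
          transport (λ t → n ≤ size t) (sym (hom t any)) (m≤n⇒m≤1+n (sizes-bound Ts any))

        sizes-bound : ∀ {ts} → All T ts → Any IsFn ts → n ≤ sizes (map G ts)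
        sizes-bound (t ∷ _)  (here f)    = ≤-trans (size-bound t f) (m≤m+n _ _)
        sizes-bound (_ ∷ ts) (there any) = ≤-trans (sizes-bound ts any) (m≤n+m _ _)

  -- The derivation up to the second `ρ`-trigger.

  -- The DRPC set without ρ-triggers other than the initial one.
  data Derived : Fact → Set where
    in-body  : ∀ {a} → a ∈ Dρ ρ → Derived a
    in-head  : ∀ {a} → a ∈ outN ρ σuc 0 → Derived a
    from-trigger : ∀ {ψ σ a} → ψ ≢ ρ → Deterministic ψ → ψ ∈ R →
                   Loaded Derived (trig ψ σ) → StarUnblockable R (trig ψ σ) →
                   a ∈ outN ψ σ 0 → Derived a

  record SecondTrigger : Set where
    field
      τ           : Subst
      loaded      : Loaded Derived (trig ρ τ)
      injective   : InjectiveOn (bodyVars ρ) τ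
      unblockable : ¬ Obsolete (O R (trig ρ τ)) (trig ρ τ)

  mutual
    derived⊎second : ∀ {a} → DRPCSet R ρ a → Derived a ⊎ SecondTrigger
    derived⊎second (d-db a∈)  = inj₁ (in-body a∈)
    derived⊎second (d-rho a∈) = inj₁ (in-head a∈)
    derived⊎second (d-trig (trig ψ σ) d (ψ∈ , _) _ loaded unb inj a∈)
      with loaded⊎second (body ψ) loaded | ψ ≟ᴿ ρ | unb
    -- A second trigger found among the premises takes precedence, so the one reported is loaded for
    -- `Derived` facts.
    ... | inj₂ second  | _        | _        = inj₂ second
    ... | inj₁ loaded′ | no ψ≢ρ   | _        = inj₁ (from-trigger ψ≢ρ d ψ∈ loaded′ unb a∈)
    ... | inj₁ _       | yes refl | inj₁ dl  = ⊥-elim (¬datalog dl)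
    ... | inj₁ loaded′ | yes refl | inj₂ ¬ob =
      inj₂ (record { τ = σ ; loaded = loaded′ ; injective = inj refl ; unblockable = ¬ob })

    loaded⊎second : ∀ {σ} as → All (λ a → DRPCSet R ρ (mapAtom σ a)) as →
                    All (λ a → Derived (mapAtom σ a)) as ⊎ SecondTrigger
    loaded⊎second []       []       = inj₁ []
    loaded⊎second (a ∷ as) (d ∷ ds) with derived⊎second d | loaded⊎second as ds
    ... | inj₂ second | _           = inj₂ second
    ... | inj₁ _      | inj₂ second = inj₂ second
    ... | inj₁ d′     | inj₁ ds′    = inj₁ (d′ ∷ ds′)

  unblockable-functional : ∀ {ψ σ v} → ψ ∈ R → StarUnblockable R (trig ψ σ) →
                           v ∈ atomsVars (headN ψ 0) → v ∉ bodyVars ψ →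
                           Any (IsFn ∘ σ) (frontier ψ)
  unblockable-functional {ψ} ψ∈ (inj₁ dl) v∈ v∉ = ⊥-elim (v∉ (datalog-vars ψ dl v∈))
  unblockable-functional ψ∈ (inj₂ ¬obs) _ _ = unblockable⇒functional _ ψ∈ ¬obs

  mutual
    derived-T : ∀ {a t} → Derived a → t ∈ terms a → T t
    derived-T (in-body a∈) t∈ with ∈-map⁻ _ a∈
    ... | b , b∈ , refl with ∈-terms-map⁻ {f = σuc} b t∈
    ... | v , v∈ , refl = t-const (∈-atomsVars⁺ b∈ v∈)
    derived-T (in-head a∈) t∈ with outTerm ρ a∈ t∈
    ... | frontier-term x∈  = t-const (proj₁ (frontier⁻ ρ x∈))
    ... | skolem-term v∈ v∉ = p-T (v∈ , v∉)
    derived-T (from-trigger {ψ} {σ} ψ≢ρ d ψ∈ loaded unb a∈) t∈ with outTerm ψ a∈ t∈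
    ... | frontier-term x∈  = loaded-T (body ψ) loaded (proj₁ (frontier⁻ ψ x∈))
    ... | skolem-term v∈ v∉ =
      t-fn ψ∈ d v∈ v∉ (length-map σ (frontier ψ)) (All.tabulate λ s∈ → case (∈-map⁻ σ s∈))
           (other ψ≢ρ (any-map⁺ (unblockable-functional ψ∈ unb v∈ v∉)))
      where
      case : ∀ {s} → ∃[ x ] (x ∈ frontier ψ × s ≡ σ x) → T s
      case (x , x∈ , refl) = loaded-T (body ψ) loaded (proj₁ (frontier⁻ ψ x∈))

    loaded-T : ∀ {σ v} as → All (λ a → Derived (mapAtom σ a)) as → v ∈ atomsVars as → T (σ v)
    loaded-T {σ} (a ∷ as) (d ∷ ds) v∈ with ∈-++⁻ (terms a) v∈
    ... | inj₁ v∈a  = derived-T d (∈-terms-map⁺ σ a v∈a)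
    ... | inj₂ v∈as = loaded-T as ds v∈as

  -- The Skolem terms of `ρ` in `T` are the `p v`, whose arguments are constants. A `ρ`-cyclic term
  -- therefore forces a second `ρ`-trigger.
  T-¬cyclic : ∀ {t} → T t → ¬ RhoCyclic ρ t
  T-¬cyclic (t-fn _ _ _ _ _ _ (other ψ≢ρ _)) (_ , _ , _ , refl , _) = ψ≢ρ refl
  T-¬cyclic (t-fn _ _ _ _ _ _ (initial refl refl)) (_ , _ , _ , refl , any) with find any
  ... | s , s∈ , _ , ⊑s with ∈-map⁻ σuc s∈
  ... | x , _ , refl with ⊑const⇒≡ ⊑s
  ... | ()

  -- Unbounded growth inside a chase leaf.

  module Leaf {L} (chase : Chase L) (closed : Closed L) where

    start⊆ : ∀ {F} → Chase F → ∀ {a} → a ∈ dbFacts database → a ∈ F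
    start⊆ start           a∈ = a∈
    start⊆ (apply _ c _ _) a∈ = ∈-++⁺ˡ (start⊆ c a∈)

    mapAtom-out : ∀ {G} → Good G → ∀ {ψ σ b} → b ∈ headN ψ 0 →
                  (∀ {v} → v ∈ terms b → T (skSubst ψ σ 0 v)) → Any (IsFn ∘ σ) (frontier ψ) →
                  mapAtom G (mapAtom (skSubst ψ σ 0) b) ≡ mapAtom (skSubst ψ (G ∘ σ) 0) b
    mapAtom-out {G} good {ψ} {σ} {b} b∈ bT any =
      trans (mapAtom-∘ G _ b) (mapAtom-local b λ v v∈ → go v (bT v∈))
      where
      go : ∀ v → T (skSubst ψ σ 0 v) → G (skSubst ψ σ 0 v) ≡ skSubst ψ (G ∘ σ) 0 v
      go v vT with v ∈? bodyVars ψ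
      ... | yes _ = refl
      ... | no _  = trans (Good.hom good vT (any-map⁺ any)) (cong (fn _) (sym (map-∘ _)))

    Contains : (Term → Term) → Set
    Contains G = (∀ {a} → a ∈ Dρ ρ → mapAtom G a ∈ L) ×
                 (∀ {a} → a ∈ outN ρ σuc 0 → mapAtom G a ∈ L)

    module _ {G} (good : Good G) (contains : Contains G) where

      mutual
        -- For a datalog rule, closure of `L` already puts the head there, as the body fixes all its
        -- variables. For a generating one, the functional frontier lets `G` commute with Skolem
        -- terms, and `Blocking.forced` applies.
        derived-image : ∀ {a} → Derived a → mapAtom G a ∈ L
        derived-image (in-body a∈) = proj₁ contains a∈
        derived-image (in-head a∈) = proj₂ contains a∈
        derived-image (from-trigger {ψ} {σ} ψ≢ρ d ψ∈ loaded unb a∈) with ∈-map⁻ _ a∈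
        ... | b , b∈ , refl with datalog? ψ d
        ... | inj₁ dl = datalog-image (closed (trig ψ (G ∘ σ)) ψ∈ (loaded-image (body ψ) loaded))
          where
          datalog-image : Obsolete (_∈F L) (trig ψ (G ∘ σ)) → mapAtom G (mapAtom (skSubst ψ σ 0) b) ∈ L
          datalog-image (suc i , i< , _) with transport (suc i <_) d i<
          ... | s≤s ()
          datalog-image (zero , _ , σ′ , agree , sat) =
            transport (_∈ L) (sym (trans (mapAtom-∘ G _ b) (mapAtom-local b same))) (All.lookup sat b∈)
            where
            same : ∀ v → v ∈ terms b → G (skSubst ψ σ 0 v) ≡ σ′ v
            same v v∈ = trans (cong G (skSubst-body ψ v∈b)) (sym (agree v v∈b))
              where v∈b = datalog-vars ψ dl (∈-atomsVars⁺ b∈ v∈)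
        derived-image der@(from-trigger {ψ} {σ} ψ≢ρ d ψ∈ loaded unb a∈)
          | b , b∈ , refl | inj₂ (w , w∈ , w∉) with unb
        ... | inj₁ dl   = ⊥-elim (w∉ (datalog-vars ψ dl w∈))
        ... | inj₂ ¬obs =
          transport (_∈ L)
            (sym (mapAtom-out good {ψ} {σ} b∈ (λ v∈ → derived-T der (∈-terms-map⁺ _ b v∈))
                                   (unblockable⇒functional _ ψ∈ ¬obs)))
            (Blocking.forced good ψ σ ψ∈ d w∈ w∉ (λ x → loaded-T (body ψ) loaded)
                             chase closed (loaded-image (body ψ) loaded) ¬obs (∈-map⁺ _ b∈))

        loaded-image : ∀ {σ} as → All (λ a → Derived (mapAtom σ a)) as →
                       All (λ a → mapAtom (G ∘ σ) a ∈ L) as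
        loaded-image []       []       = []
        loaded-image (a ∷ as) (d ∷ ds) =
          transport (_∈ L) (mapAtom-∘ G _ a) (derived-image d) ∷ loaded-image as ds

    -- The database was chosen as the flattening of the initial body and head.
    contains-flatten : Contains flatten
    contains-flatten = in-body′ , in-head′
      where
      db : ∀ b → b ∈ body ρ ++ headN ρ 0 → mapAtom σuc b ∈ L
      db b b∈ = start⊆ chase (transport (_∈ dbFacts database) (mapAtom-∘ const nat b)
                                (∈-map⁺ _ (∈-map⁺ _ b∈)))
      in-body′ : ∀ {a} → a ∈ Dρ ρ → mapAtom flatten a ∈ L
      in-body′ a∈ with ∈-map⁻ _ a∈
      ... | b , b∈ , refl = transport (_∈ L) (sym (mapAtom-∘ flatten σuc b)) (db b (∈-++⁺ˡ b∈))
      in-head′ : ∀ {a} → a ∈ outN ρ σuc 0 → mapAtom flatten a ∈ L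
      in-head′ a∈ with ∈-map⁻ _ a∈
      ... | b , b∈ , refl =
        transport (_∈ L) (sym (trans (mapAtom-∘ flatten _ b) (mapAtom-local b λ v _ → flat-v v)))
                  (db b (∈-++⁺ʳ (body ρ) b∈))
        where
        flat-v : ∀ v → flatten (skSubst ρ σuc 0 v) ≡ σuc v
        flat-v v with v ∈? bodyVars ρ
        ... | yes _ = refl
        ... | no _  = flatten-ρ v _

    module _ (second : SecondTrigger) where
      open SecondTrigger second

      τT : ∀ x → x ∈ bodyVars ρ → T (τ x)
      τT x = loaded-T (body ρ) loaded

      functional : Any (IsFn ∘ τ) (frontier ρ)
      functional = unblockable⇒functional _ ρ∈R unblockable

      -- The `next G τ` image of the initial trigger is the `G`-image of the second one: its body is
      -- replayed by `loaded-image`, and its head is forced.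
      contains-next : ∀ {G} → Good G → Contains G → Contains (next G τ)
      contains-next {G} good contains = in-body′ , in-head′
        where
        image : Loaded (_∈F L) (trig ρ (G ∘ τ))
        image = loaded-image good contains (body ρ) loaded
        in-body′ : ∀ {a} → a ∈ Dρ ρ → mapAtom (next G τ) a ∈ L
        in-body′ a∈ with ∈-map⁻ _ a∈
        ... | b , b∈ , refl =
          transport (_∈ L) (sym (mapAtom-∘ (next G τ) σuc b)) (All.lookup image b∈)
        in-head′ : ∀ {a} → a ∈ outN ρ σuc 0 → mapAtom (next G τ) a ∈ L
        in-head′ a∈ with ∈-map⁻ _ a∈ | exVar
        ... | b , b∈ , refl | w , w∈ , w∉ =
          transport (_∈ L) (sym (trans (mapAtom-∘ (next G τ) _ b) (mapAtom-local b λ v _ → next-v v)))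
            (Blocking.forced good ρ τ ρ∈R det w∈ w∉ τT chase closed image unblockable (∈-map⁺ _ b∈))
          where
          next-v : ∀ v → next G τ (skSubst ρ σuc 0 v) ≡ skSubst ρ (G ∘ τ) 0 v
          next-v v with v ∈? bodyVars ρ
          ... | yes _ = refl
          ... | no _  = Next.G′-p good τ τT injective functional v

      G : ℕ → Term → Term
      G zero    = flatten
      G (suc k) = next (G k) τ

      G-good : ∀ k → Good (G k)
      G-good zero    = flatten-good
      G-good (suc k) = Next.next-good (G-good k) τ τT injective functional

      G-contains : ∀ k → Contains (G k)
      G-contains zero    = contains-flatten
      G-contains (suc k) = contains-next (G-good k) (G-contains k)

      G-size : ∀ k v → ExVar v → k ≤ size (G k (p v))
      G-size zero    v _ = z≤n
      G-size (suc k) v _ = Next.size-next (G-good k) τ τT injective functional v (G-size k)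

      impossible : ⊥
      impossible with exVar
      ... | v , ex@(v∈ , v∉) with ∈-outN-terms⁺ ρ σuc 0 v∈
      ... | a , a∈ , t∈ = <-irrefl refl (≤-trans (G-size K v ex) (∈⇒size≤ occurs))
        where
        -- One more than the total size of all terms in `L`, so no term of `L` has size `K` or more.
        K = suc (sizes (concatMap terms L))
        occurs : G K (p v) ∈ concatMap terms L
        occurs = ∈-concatMap⁺ terms (lose (proj₂ (G-contains K) a∈)
          (∈-terms-map⁺ (G K) a (transport (_∈ terms a) (skSubst-∃ ρ v∉) t∈)))

theorem6 : (R : List Rule) → DRPC R → NeverTerminates R
theorem6 R (ρ , ρ∈ , det , ¬datalog , a , drpc , cyclic) = database , λ tree →
  let L , chase , closed = leftmostLeaf tree start in
  Leaf.impossible chase closed second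
  where
  open Prefix R ρ ρ∈ det ¬datalog
  second : SecondTrigger
  second with derived⊎second drpc | find cyclic
  ... | inj₂ s | _            = s
  ... | inj₁ d | t , t∈ , cyc = ⊥-elim (T-¬cyclic (derived-T d t∈) cyc)
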